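{- Let $\mathbf p$ be a poset and let $\alpha$ be a countably infinite ordinal. If the ordering of $\mathbf p$ is the intersection of a WPO ordering of length $\omega$ and a WPO ordering of length $\alpha$ (both on the vertex set of $\mathbf p$), then $\ell(\mathbf p)=\alpha$.
   Context: Orderings are partial orders, seen as sets of ordered pairs; the intersection of orderings on the same set is their set-theoretic intersection. A poset is well partially ordered (WPO) if it is well founded and has no infinite antichain; equivalently all its linear extensions are well orders. The length $\ell(\mathbf p)$ of a WPO $\mathbf p$ is the largest ordinal type of a linear extension of $\mathbf p$ (the maximum exists by de Jongh–Parikh). The length of an ordering is the length of the corresponding poset. -}

module Defs where

open import Data.Nat.Base as ℕ using (ℕ)
import Data.Nat.Properties as ℕ
open import Data.Nat.Induction using (<-wellFounded)
open import Data.Product.Base using (_×_; _,_; ∃; ∃-syntax)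
open import Function.Bundles using (Bijection)
open import Induction.WellFounded using (WellFounded; module Subrelation)
open import Level using (Level; 0ℓ; _⊔_; suc)
open import Relation.Binary.Bundles using (TotalOrder)
open import Relation.Binary.Core using (Rel; _⇒_)
open import Relation.Binary.Morphism.Structures
  using (IsOrderMonomorphism; IsOrderIsomorphism)
open import Relation.Binary.PropositionalEquality.Core using (_≢_)
import Relation.Binary.PropositionalEquality.Properties as ≡
open import Relation.Binary.Structures using (IsPartialOrder; IsTotalOrder)
import Relation.Binary.Construct.NonStrictToStrict as Strict
open import Relation.Nullary.Negation using (¬_)

-- Orderings are reflexive; well-foundedness always refers to the strict part
-- x < y  :=  x ≤ y × ¬ (x ≈ y).

WellFoundedOrder : ∀ {a ℓ₁ ℓ₂} {A : Set a} →
                   Rel A ℓ₁ → Rel A ℓ₂ → Set (a ⊔ ℓ₁ ⊔ ℓ₂)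
WellFoundedOrder _≈_ _≤_ = WellFounded (Strict._<_ _≈_ _≤_)

-- An infinite antichain is given by a sequence of pairwise incomparable
-- elements.  As i and j range over all ordered pairs of distinct indices, both
-- ¬ (f i ≤ f j) and ¬ (f j ≤ f i) are required; by reflexivity the terms are
-- then pairwise distinct.

InfiniteAntichain : ∀ {a ℓ} {A : Set a} → Rel A ℓ → Set (a ⊔ ℓ)
InfiniteAntichain {A = A} _≤_ =
  ∃ λ (f : ℕ → A) → ∀ i j → i ≢ j → ¬ (f i ≤ f j)

record IsWPO {a ℓ₁ ℓ₂} {A : Set a} (_≈_ : Rel A ℓ₁) (_≤_ : Rel A ℓ₂)
             : Set (a ⊔ ℓ₁ ⊔ ℓ₂) where
  field
    isPartialOrder      : IsPartialOrder _≈_ _≤_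
    wellFounded         : WellFoundedOrder _≈_ _≤_
    noInfiniteAntichain : ¬ InfiniteAntichain _≤_

IsLinearExtension : ∀ {a ℓ₁ ℓ₂ ℓ₃} {A : Set a} →
                    Rel A ℓ₁ → Rel A ℓ₂ → Rel A ℓ₃ → Set (a ⊔ ℓ₁ ⊔ ℓ₂ ⊔ ℓ₃)
IsLinearExtension _≈_ _≤_ _≤ᴸ_ = IsTotalOrder _≈_ _≤ᴸ_ × _≤_ ⇒ _≤ᴸ_

-- Ordinals are represented by well-ordered sets; two of them represent the
-- same ordinal when they are order isomorphic, and every notion below that
-- mentions an ordinal is invariant under order isomorphism.

record Ordinal a ℓ₁ ℓ₂ : Set (suc (a ⊔ ℓ₁ ⊔ ℓ₂)) where
  field
    totalOrder : TotalOrder a ℓ₁ ℓ₂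
  open TotalOrder totalOrder public
  field
    wellFounded : WellFoundedOrder _≈_ _≤_

ω : Ordinal 0ℓ 0ℓ 0ℓ
ω = record
  { totalOrder  = ℕ.≤-totalOrder
  ; wellFounded = Subrelation.wellFounded
      (λ (m≤n , m≢n) → ℕ.≤∧≢⇒< m≤n m≢n) <-wellFounded
  }

CountablyInfinite : ∀ {a ℓ₁ ℓ₂} → Ordinal a ℓ₁ ℓ₂ → Set (a ⊔ ℓ₁)
CountablyInfinite α = Bijection (≡.setoid ℕ) (Ordinal.Eq.setoid α)

-- The order on ordinals: β is isomorphic to an initial segment of α.

infix 4 _≼_

_≼_ : ∀ {b ℓ₁ ℓ₂ a ℓ₃ ℓ₄} → Ordinal b ℓ₁ ℓ₂ → Ordinal a ℓ₃ ℓ₄ →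
      Set (b ⊔ ℓ₁ ⊔ ℓ₂ ⊔ a ⊔ ℓ₃ ⊔ ℓ₄)
β ≼ α = ∃[ f ] (IsOrderMonomorphism β._≈_ α._≈_ β._≤_ α._≤_ f
              × (∀ x y → y α.≤ f x → ∃[ x′ ] f x′ α.≈ y))
  where
  module β = Ordinal β
  module α = Ordinal α

HasOrdinalType : ∀ {c ℓ₁ ℓ₂ a ℓ₃ ℓ₄} {A : Set c} →
                 Rel A ℓ₁ → Rel A ℓ₂ → Ordinal a ℓ₃ ℓ₄ →
                 Set (c ⊔ ℓ₁ ⊔ ℓ₂ ⊔ a ⊔ ℓ₃ ⊔ ℓ₄)
HasOrdinalType _≈_ _≤_ α =
  ∃[ f ] IsOrderIsomorphism _≈_ (Ordinal._≈_ α) _≤_ (Ordinal._≤_ α) f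

-- ℓ(A , ≤) = α.  Length is a relation because ordinals are only given up to
-- isomorphism, and it is only defined for WPOs, hence the first field.  In
-- maximal, the levels of β are those of the order _≤ᴸ_ on A, so that when that
-- order is a well order it is itself one of the β.

record HasLength {c ℓ₁ ℓ₂ a ℓ₃ ℓ₄} {A : Set c}
                 (_≈_ : Rel A ℓ₁) (_≤_ : Rel A ℓ₂) (α : Ordinal a ℓ₃ ℓ₄)
                 : Set (suc (c ⊔ ℓ₁ ⊔ ℓ₂) ⊔ a ⊔ ℓ₃ ⊔ ℓ₄) where
  field
    isWPO    : IsWPO _≈_ _≤_
    attained : ∃[ _≤ᴸ_ ] (IsLinearExtension {ℓ₃ = ℓ₂} _≈_ _≤_ _≤ᴸ_
                        × HasOrdinalType _≈_ _≤ᴸ_ α)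
    maximal  : ∀ (_≤ᴸ_ : Rel A ℓ₂) → IsLinearExtension _≈_ _≤_ _≤ᴸ_ →
               ∀ (β : Ordinal c ℓ₁ ℓ₂) → HasOrdinalType _≈_ _≤ᴸ_ β → β ≼ α

{-# OPTIONS --safe #-}
-- For S ⊆ A let o(S) = sup { o({y ∈ S : x ≰₂ y}) + 1 : x ∈ S } be the rank of
-- the tree of bad sequences of ≤₂ in S.  As ≤₁ has length ω, every x lies
-- ≤₁-below all but finitely many elements, so in a linear extension L of p only
-- finitely many y <ᴸ x satisfy x ≤₂ y; since adding a point with finitely many
-- points above it increases o, the type of L is at most o(A).  A version of the
-- de Jongh–Parikh theorem then yields a map h with h y ≰₂ h x whenever x <ᴸ y.
-- Sorting the elements y by the least x with y ≤₂ h x, and ties by any linear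
-- extension of ≤₂, gives a linear extension of ≤₂ into which h embeds L.  Its
-- type is at most α, hence so is that of L.
--
-- For de Jongh–Parikh at a limit β, let H be the least η such that
-- δ ⊕ η ≥ β for some δ < β, if one exists.  Then H is closed under ⊕ and
-- β ≤ G + H for some G < β.  Take S with o(S) ≥ β and o({y ∈ S : x ≰ y}) < β for
-- all x ∈ S.  From o(S) ≤ o({y ∈ S : x ≰ y}) ⊕ o({y ∈ S : x ≤ y}) every upper cone
-- of S has o ≥ H, so a realisation of G below some x can be followed by one of H
-- above x.  If there is no such η, every upper cone has o ≥ β, and realisations of
-- cofinally many ordinals are stacked along an increasing sequence.
module Submission where

open import Defs
open import Axiom.ExcludedMiddle using (ExcludedMiddle)
open import Data.Empty using (⊥-elim)
open import Data.Nat.Base as ℕ using (ℕ; zero; suc)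
open import Data.Nat.Induction using (<-wellFounded)
import Data.Nat.Properties as ℕ
open import Data.Product.Base using (Σ; ∃; ∃-syntax; _×_; _,_; proj₁; proj₂)
open import Data.Sum.Base using (_⊎_; inj₁; inj₂; [_,_]′)
open import Data.Unit.Base using (tt)
open import Function.Base using (id; _∘_)
open import Induction.WellFounded using (WellFounded; Acc; acc; module Subrelation)
import Level
open Level using (Level; 0ℓ; _⊔_; Lift; lift)
open import Relation.Binary.Bundles using (Poset)
open import Relation.Binary.Core using (Rel; _⇒_; _⇔_)
open import Relation.Binary.Construct.Intersection using (_∩_)
import Relation.Binary.Construct.NonStrictToStrict as Strict
import Relation.Binary.Construct.On as On
open import Relation.Binary.Definitions
  using (Reflexive; Transitive; Antisymmetric; Total; tri<; tri≈; tri>)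
open import Relation.Binary.Morphism.Structures
  using (IsOrderMonomorphism; IsOrderIsomorphism)
open import Relation.Binary.PropositionalEquality as ≡ using (_≡_; refl; sym; subst)
open import Relation.Binary.Structures using (IsPartialOrder; IsTotalOrder)
open import Relation.Nullary using (¬_; Dec; yes; no)
open import Relation.Nullary.Decidable using (True; toWitness; fromWitness)
open import Relation.Unary using (Pred; _⊆_; U)

-- Ordinals represented by well-founded trees.

private variable
  ℓa ℓb ℓc : Level

-- node f stands for the ordinal sup { f i + 1 }; distinct trees may denote the
-- same ordinal, equality of ordinals being ⊑ in both directions.
data Tree ℓ : Set (Level.suc ℓ) where
  node : {I : Set ℓ} → (I → Tree ℓ) → Tree ℓ

infix 4 _⊑_ _⊏_

-- The two levels are independent so that ranks taken in well-orders from different universes can be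
-- compared.
_⊑_ : Tree ℓa → Tree ℓb → Set (ℓa ⊔ ℓb)
node f ⊑ node g = ∀ i → ∃ λ j → f i ⊑ g j

_⊏_ : Tree ℓa → Tree ℓb → Set (ℓa ⊔ ℓb)
a ⊏ node g = ∃ λ j → a ⊑ g j

⊑-refl : (a : Tree ℓa) → a ⊑ a
⊑-refl (node f) i = i , ⊑-refl (f i)

⊑-trans : (a : Tree ℓa) (b : Tree ℓb) (c : Tree ℓc) → a ⊑ b → b ⊑ c → a ⊑ c
⊑-trans (node f) (node g) (node h) p q i with p i
... | j , fi⊑gj with q j
...   | k , gj⊑hk = k , ⊑-trans (f i) (g j) (h k) fi⊑gj gj⊑hk

⊑-⊏-trans : (a : Tree ℓa) (b : Tree ℓb) (c : Tree ℓc) → a ⊑ b → b ⊏ c → a ⊏ c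
⊑-⊏-trans a b (node h) p (k , q) = k , ⊑-trans a b (h k) p q

⊏-⊑-trans : (a : Tree ℓa) (b : Tree ℓb) (c : Tree ℓc) → a ⊏ b → b ⊑ c → a ⊏ c
⊏-⊑-trans a (node g) (node h) (j , p) q =
  let k , r = q j in k , ⊑-trans a (g j) (h k) p r

child : {I : Set ℓa} (f : I → Tree ℓa) (i : I) → f i ⊏ node f
child f i = i , ⊑-refl (f i)

⊏⇒⊑ : (a : Tree ℓa) (b : Tree ℓb) → a ⊏ b → a ⊑ b
⊏⇒⊑ (node f) (node g) (j , p) i =
  j , ⊏⇒⊑ (f i) (g j) (⊏-⊑-trans (f i) (node f) (g j) (child f i) p)

⊏-trans : (a : Tree ℓa) (b : Tree ℓb) (c : Tree ℓc) → a ⊏ b → b ⊏ c → a ⊏ c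
⊏-trans a b c p q = ⊑-⊏-trans a b c (⊏⇒⊑ a b p) q

⊏-irrefl : (a : Tree ℓa) → ¬ (a ⊏ a)
⊏-irrefl (node f) (i , p) =
  ⊏-irrefl (f i) (⊏-⊑-trans (f i) (node f) (f i) (child f i) p)

⊏⇒⋢ : (a : Tree ℓa) (b : Tree ℓb) → a ⊏ b → ¬ (b ⊑ a)
⊏⇒⋢ a b p q = ⊏-irrefl a (⊏-⊑-trans a b a p q)

⊑-build : (a : Tree ℓa) (b : Tree ℓb) → (∀ (c : Tree ℓa) → c ⊏ a → c ⊏ b) → a ⊑ b
⊑-build (node f) (node g) p i = p (f i) (child f i)

-- As `⊏` is wider than the child relation, accessibility is proved for every `a ⊑ b` at once, by
-- recursion on the structure of `b`.
⊏-wellFounded : WellFounded (_⊏_ {ℓa} {ℓa})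
⊏-wellFounded b = below b (⊑-refl b)
  where
  below : (b {a} : Tree ℓa) → a ⊑ b → Acc _⊏_ a
  below (node g) {a} p = acc λ {c} q →
    let j , r = ⊏-⊑-trans c a (node g) q p in below (g j) r

-- Ordinary and natural sums of ordinals.

infixl 6 _∔_ _⊕_

-- Keeping the children of `a` makes `a` itself the sum when the second tree has no children.
_∔_ : Tree ℓa → Tree ℓa → Tree ℓa
a@(node f) ∔ node g = node [ f , (λ j → a ∔ g j) ]′

-- The natural (Hessenberg) sum.
_⊕_ : Tree ℓa → Tree ℓa → Tree ℓa
a@(node f) ⊕ b@(node g) = node [ (λ i → f i ⊕ b) , (λ j → a ⊕ g j) ]′

module Arithmetic {ℓ : Level} where

  private T = Tree ℓ

  ∔-⊏ʳ : (a {b} c : T) → b ⊏ c → a ∔ b ⊏ a ∔ c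
  ∔-⊑ʳ : (a b c : T) → b ⊑ c → a ∔ b ⊑ a ∔ c
  ∔-⊏ʳ a@(node _) {b} (node h) (k , p) = inj₂ k , ∔-⊑ʳ a b (h k) p
  ∔-⊑ʳ a@(node f) (node g) (node h) p (inj₁ i) = inj₁ i , ⊑-refl (f i)
  ∔-⊑ʳ a@(node f) (node g) (node h) p (inj₂ j) =
    let k , q = p j in inj₂ k , ∔-⊑ʳ a (g j) (h k) q

  ∔-⊑ˡ : (a b c : T) → a ⊑ b → a ∔ c ⊑ b ∔ c
  ∔-⊑ˡ a@(node f) b@(node g) (node h) p (inj₁ i) = let j , q = p i in inj₁ j , q
  ∔-⊑ˡ a@(node f) b@(node g) (node h) p (inj₂ k) = inj₂ k , ∔-⊑ˡ a b (h k) p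

  a⊑a∔b : (a b : T) → a ⊑ a ∔ b
  a⊑a∔b (node f) (node g) i = inj₁ i , ⊑-refl (f i)

  ⊏-∔⁻ : (a b c : T) → c ⊏ a ∔ b → c ⊏ a ⊎ (∃ λ d → d ⊏ b × c ⊑ a ∔ d)
  ⊏-∔⁻ (node f) (node g) c (inj₁ i , p) = inj₁ (i , p)
  ⊏-∔⁻ (node f) (node g) c (inj₂ j , p) = inj₂ (g j , child g j , p)

  ∔-assoc : (a b c : T) → (a ∔ b) ∔ c ⊑ a ∔ (b ∔ c)
  ∔-assoc a@(node f) b@(node g) (node h) (inj₁ (inj₁ i)) = inj₁ i , ⊑-refl (f i)
  ∔-assoc a@(node f) b@(node g) (node h) (inj₁ (inj₂ j)) =
    inj₂ (inj₁ j) , ⊑-refl (a ∔ g j)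
  ∔-assoc a@(node f) b@(node g) (node h) (inj₂ k) =
    inj₂ (inj₂ k) , ∔-assoc a b (h k)

  ⊏-⊕⁻ : (a b c : T) → c ⊏ a ⊕ b →
         (∃ λ d → d ⊏ a × c ⊑ d ⊕ b) ⊎ (∃ λ d → d ⊏ b × c ⊑ a ⊕ d)
  ⊏-⊕⁻ (node f) (node g) c (inj₁ i , p) = inj₁ (f i , child f i , p)
  ⊏-⊕⁻ (node f) (node g) c (inj₂ j , p) = inj₂ (g j , child g j , p)

  ⊕-mono : (a a′ b b′ : T) → a ⊑ a′ → b ⊑ b′ → a ⊕ b ⊑ a′ ⊕ b′
  ⊕-mono a@(node f) a′@(node f′) b@(node g) b′@(node g′) p q (inj₁ i) =
    let i′ , r = p i in inj₁ i′ , ⊕-mono (f i) (f′ i′) b b′ r q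
  ⊕-mono a@(node f) a′@(node f′) b@(node g) b′@(node g′) p q (inj₂ j) =
    let j′ , r = q j in inj₂ j′ , ⊕-mono a a′ (g j) (g′ j′) p r

  ⊕-⊏ˡ : (a b c : T) → a ⊏ b → a ⊕ c ⊏ b ⊕ c
  ⊕-⊏ˡ a (node g) c@(node _) (j , p) = inj₁ j , ⊕-mono a (g j) c c p (⊑-refl c)

  ⊕-⊏ʳ : (a b c : T) → b ⊏ c → a ⊕ b ⊏ a ⊕ c
  ⊕-⊏ʳ a@(node _) b (node h) (k , p) = inj₂ k , ⊕-mono a a b (h k) (⊑-refl a) p

  ⊕-assoc : (a b c : T) → a ⊕ (b ⊕ c) ⊑ (a ⊕ b) ⊕ c
  ⊕-assoc a@(node f) b@(node g) c@(node h) (inj₁ i) =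
    inj₁ (inj₁ i) , ⊕-assoc (f i) b c
  ⊕-assoc a@(node f) b@(node g) c@(node h) (inj₂ (inj₁ j)) =
    inj₁ (inj₂ j) , ⊕-assoc a (g j) c
  ⊕-assoc a@(node f) b@(node g) c@(node h) (inj₂ (inj₂ k)) =
    inj₂ k , ⊕-assoc a b (h k)

  a⊑a⊕b : (a b : T) → a ⊑ a ⊕ b
  a⊑a⊕b a@(node f) b@(node _) i = inj₁ i , a⊑a⊕b (f i) b

  ∔⊑⊕ : (a b : T) → a ∔ b ⊑ a ⊕ b
  ∔⊑⊕ a@(node f) b@(node _) (inj₁ i) = inj₁ i , a⊑a⊕b (f i) b
  ∔⊑⊕ a@(node f) b@(node g) (inj₂ j) = inj₂ j , ∔⊑⊕ a (g j)

-- Linearity of the ordinals under excluded middle.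

module Classical (lem : ∀ {ℓ} → ExcludedMiddle ℓ) where

  by-contradiction : ∀ {ℓ} {P : Set ℓ} → ¬ ¬ P → P
  by-contradiction {P = P} ¬¬p with lem {P = P}
  ... | yes p = p
  ... | no ¬p = ⊥-elim (¬¬p ¬p)

  -- A child `f i` that is not below `b` dominates every `c ⊏ b`, because `f i ⊑ c` would put it
  -- below `b`; so recursion on the first tree suffices.
  ⊑-or-⊐ : (a : Tree ℓa) (b : Tree ℓb) → a ⊑ b ⊎ b ⊏ a
  ⊑-or-⊐ {ℓa} {ℓb} (node f) b with lem {P = ∃ λ i → ¬ (f i ⊏ b)}
  ... | yes (i , ¬p) = inj₂ (i , b⊑fi)
    where
    b⊑fi : b ⊑ f i
    b⊑fi = ⊑-build b (f i) λ c c⊏b →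
      [ (λ fi⊑c → ⊥-elim (¬p (⊑-⊏-trans (f i) c b fi⊑c c⊏b))) , id ]′ (⊑-or-⊐ (f i) c)
  ... | no ¬∃ = inj₁ (⊑-build (node f) b below)
    where
    below : ∀ c → c ⊏ node f → c ⊏ b
    below c (i , p) with lem {P = f i ⊏ b}
    ... | yes q = ⊑-⊏-trans c (f i) b p q
    ... | no ¬q = ⊥-elim (¬∃ (i , ¬q))

  ⋢⇒⊐ : (a : Tree ℓa) (b : Tree ℓb) → ¬ (a ⊑ b) → b ⊏ a
  ⋢⇒⊐ a b ¬p with ⊑-or-⊐ a b
  ... | inj₁ p = ⊥-elim (¬p p)
  ... | inj₂ q = q

  ⊏̸⇒⊒ : (a : Tree ℓa) (b : Tree ℓb) → ¬ (a ⊏ b) → b ⊑ a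
  ⊏̸⇒⊒ a b ¬p with ⊑-or-⊐ b a
  ... | inj₁ p = p
  ... | inj₂ q = ⊥-elim (¬p q)

  least : (P : Tree ℓa → Set ℓc) {a : Tree ℓa} → P a → ∃ λ b → P b × ∀ c → P c → b ⊑ c
  least {ℓa} P {a} = go (⊏-wellFounded a)
    where
    go : ∀ {a} → Acc _⊏_ a → P a → ∃ λ b → P b × ∀ c → P c → b ⊑ c
    go {a} (acc rs) pa with lem {P = ∃ λ c → P c × c ⊏ a}
    ... | yes (c , pc , c⊏a) = go (rs c⊏a) pc
    ... | no ¬∃ = a , pa , λ c pc → ⊏̸⇒⊒ c a λ c⊏a → ¬∃ (c , pc , c⊏a)

  -- Additively closed ordinals, division by them, and the last term of a normal form.

  module _ {ℓ : Level} where
    open Arithmetic {ℓ}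
    private T = Tree ℓ

    ⊕-zero : (a b : T) → (∀ (c : T) → ¬ (c ⊏ b)) → a ⊕ b ⊑ a
    ⊕-zero a@(node f) b@(node g) empty (inj₁ i) = i , ⊕-zero (f i) b empty
    ⊕-zero a@(node f) b@(node g) empty (inj₂ j) = ⊥-elim (empty (g j) (child g j))

    -- Among nonzero ordinals these are the powers of ω.
    Closed : T → Set (Level.suc ℓ)
    Closed H = ∀ a b → a ⊏ H → b ⊏ H → a ⊕ b ⊏ H

    -- A is of the form H · ζ.
    Multiple : T → T → Set (Level.suc ℓ)
    Multiple H A = ∀ c → c ⊏ A → c ∔ H ⊑ A

    module _ (H : T) (closed : Closed H) (nonempty : ∃ λ (c : T) → c ⊏ H) where

      -- The ordinary sum is bounded by the natural sum, under which `H` is closed.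
      absorbs : ∀ ρ → ρ ⊏ H → ρ ∔ H ⊑ H
      absorbs ρ ρ⊏H = ⊑-build (ρ ∔ H) H below
        where
        below : ∀ c → c ⊏ ρ ∔ H → c ⊏ H
        below c p with ⊏-∔⁻ ρ H c p
        ... | inj₁ c⊏ρ = ⊏-trans c ρ H c⊏ρ ρ⊏H
        ... | inj₂ (d , d⊏H , c⊑) = ⊑-⊏-trans c (ρ ∔ d) H c⊑
          (⊑-⊏-trans (ρ ∔ d) (ρ ⊕ d) H (∔⊑⊕ ρ d) (closed ρ d ρ⊏H d⊏H))

      -- `quotient` is the multiple H · ζ itself and not ζ, so no product of trees has to be
      -- defined.
      record Division (δ : T) : Set (Level.suc ℓ) where
        constructor division
        field
          quotient remainder : T
          quotient⊑          : quotient ⊑ δ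
          multiple           : Multiple H quotient
          remainder⊏         : remainder ⊏ H
          bound              : δ ⊑ quotient ∔ remainder

      -- The quotient is the least `A` with `δ ⊏ A ∔ H`. If `A ⊏ c ∔ H` for some `c ⊏ A`, then
      -- `A ⊑ c ∔ ρ` with `ρ ⊏ H`, and since `H` absorbs `ρ` already `δ ⊏ c ∔ H`, against
      -- minimality.
      divide : ∀ δ → Division δ
      divide δ with least (λ A → δ ⊏ A ∔ H) {δ}
                     (⊑-⊏-trans δ (δ ∔ proj₁ nonempty) (δ ∔ H) (a⊑a∔b δ _)
                       (∔-⊏ʳ δ H (proj₂ nonempty)))
      ... | A , δ⊏A∔H , A-least = split (⊏-∔⁻ A H δ δ⊏A∔H)
        where
        lower : ∀ c → c ⊏ A → ¬ (δ ⊏ c ∔ H)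
        lower c c⊏A p = ⊏⇒⋢ c A c⊏A (A-least c p)

        A⊑δ : A ⊑ δ
        A⊑δ = ⊏̸⇒⊒ δ A λ δ⊏A → lower δ δ⊏A
          (⊑-⊏-trans δ (δ ∔ proj₁ nonempty) (δ ∔ H) (a⊑a∔b δ _)
            (∔-⊏ʳ δ H (proj₂ nonempty)))

        A-multiple : Multiple H A
        A-multiple c c⊏A = ⊏̸⇒⊒ A (c ∔ H) contra
          where
          contra : ¬ (A ⊏ c ∔ H)
          contra p with ⊏-∔⁻ c H A p
          ... | inj₁ A⊏c = ⊏-irrefl A (⊏-trans A c A A⊏c c⊏A)
          ... | inj₂ (ρ , ρ⊏H , A⊑c∔ρ) = lower c c⊏A
            (⊏-⊑-trans δ (A ∔ H) (c ∔ H) δ⊏A∔H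
              (⊑-trans (A ∔ H) ((c ∔ ρ) ∔ H) (c ∔ H) (∔-⊑ˡ A (c ∔ ρ) H A⊑c∔ρ)
                (⊑-trans ((c ∔ ρ) ∔ H) (c ∔ (ρ ∔ H)) (c ∔ H) (∔-assoc c ρ H)
                  (∔-⊑ʳ c (ρ ∔ H) H (absorbs ρ ρ⊏H)))))

        split : δ ⊏ A ⊎ (∃ λ ρ → ρ ⊏ H × δ ⊑ A ∔ ρ) → Division δ
        split (inj₁ δ⊏A) = ⊥-elim (⊏⇒⋢ δ A δ⊏A A⊑δ)
        split (inj₂ (ρ , ρ⊏H , δ⊑)) = division A ρ A⊑δ A-multiple ρ⊏H δ⊑

      -- In Cantor normal form the terms of `A` are at least `H` and those of `ρ` and `η` smaller,
      -- so only the tails are merged. In the induction, an ordinal `d ⊏ A` is divided by `H` as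
      -- `A′ ∔ σ`, and the hypothesis for `A′` keeps `d ⊕ η` below `A′ ∔ H ⊑ A`.
      ∔⊕-small : ∀ {A} → Acc _⊏_ A → Multiple H A → ∀ ρ η → ρ ⊏ H → η ⊏ H →
                 (A ∔ ρ) ⊕ η ⊑ A ∔ (ρ ⊕ η)
      ∔⊕-small {A} (acc rs) mult ρ η = go (⊏-wellFounded ρ) (⊏-wellFounded η)
        where
        go : ∀ {ρ η} → Acc _⊏_ ρ → Acc _⊏_ η → ρ ⊏ H → η ⊏ H → (A ∔ ρ) ⊕ η ⊑ A ∔ (ρ ⊕ η)
        go {ρ} {η} (acc rsρ) (acc rsη) ρ⊏H η⊏H =
          ⊑-build ((A ∔ ρ) ⊕ η) (A ∔ (ρ ⊕ η)) λ c c⊏ → below c (⊏-⊕⁻ (A ∔ ρ) η c c⊏)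
          where
          goal : T
          goal = A ∔ (ρ ⊕ η)
          below : ∀ c → (∃ λ d → d ⊏ A ∔ ρ × c ⊑ d ⊕ η) ⊎ (∃ λ d → d ⊏ η × c ⊑ (A ∔ ρ) ⊕ d) →
                  c ⊏ goal
          below c (inj₂ (d , d⊏η , c⊑)) = ⊑-⊏-trans c ((A ∔ ρ) ⊕ d) goal c⊑
            (⊑-⊏-trans ((A ∔ ρ) ⊕ d) (A ∔ (ρ ⊕ d)) goal
              (go (acc rsρ) (rsη d⊏η) ρ⊏H (⊏-trans d η H d⊏η η⊏H))
              (∔-⊏ʳ A (ρ ⊕ η) (⊕-⊏ʳ ρ d η d⊏η)))
          below c (inj₁ (d , d⊏ , c⊑)) with ⊏-∔⁻ A ρ d d⊏
          ... | inj₂ (ρ′ , ρ′⊏ρ , d⊑) = ⊑-⊏-trans c ((A ∔ ρ′) ⊕ η) goal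
            (⊑-trans c (d ⊕ η) ((A ∔ ρ′) ⊕ η) c⊑ (⊕-mono d (A ∔ ρ′) η η d⊑ (⊑-refl η)))
            (⊑-⊏-trans ((A ∔ ρ′) ⊕ η) (A ∔ (ρ′ ⊕ η)) goal
              (go (rsρ ρ′⊏ρ) (acc rsη) (⊏-trans ρ′ ρ H ρ′⊏ρ ρ⊏H) η⊏H)
              (∔-⊏ʳ A (ρ ⊕ η) (⊕-⊏ˡ ρ′ ρ η ρ′⊏ρ)))
          ... | inj₁ d⊏A = ⊏-⊑-trans c A goal c⊏A (a⊑a∔b A (ρ ⊕ η))
            where
            open Division (divide d) renaming (quotient to A′; remainder to σ)
            A′⊏A = ⊑-⊏-trans A′ d A quotient⊑ d⊏A
            c⊏A : c ⊏ A
            c⊏A = ⊑-⊏-trans c (A′ ∔ (σ ⊕ η)) A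
              (⊑-trans c (d ⊕ η) (A′ ∔ (σ ⊕ η)) c⊑
                (⊑-trans (d ⊕ η) ((A′ ∔ σ) ⊕ η) (A′ ∔ (σ ⊕ η))
                  (⊕-mono d (A′ ∔ σ) η η bound (⊑-refl η))
                  (∔⊕-small (rs A′⊏A) multiple σ η remainder⊏ η⊏H)))
              (⊏-⊑-trans (A′ ∔ (σ ⊕ η)) (A′ ∔ H) A
                (∔-⊏ʳ A′ H (closed σ η remainder⊏ η⊏H)) (mult A′ A′⊏A))

      -- The natural sum inserts the term `H` in its place in the normal form, after `A` and before
      -- `ρ`.
      ∔⊕-commute : ∀ {A} → Acc _⊏_ A → Multiple H A → ∀ ρ → ρ ⊏ H →
                   (A ∔ ρ) ⊕ H ⊑ (A ∔ H) ∔ ρ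
      ∔⊕-commute {A} (acc rs) mult ρ = go (⊏-wellFounded ρ)
        where
        go : ∀ {ρ} → Acc _⊏_ ρ → ρ ⊏ H → (A ∔ ρ) ⊕ H ⊑ (A ∔ H) ∔ ρ
        go {ρ} (acc rsρ) ρ⊏H =
          ⊑-build ((A ∔ ρ) ⊕ H) goal λ c c⊏ → below c (⊏-⊕⁻ (A ∔ ρ) H c c⊏)
          where
          goal : T
          goal = (A ∔ H) ∔ ρ
          below : ∀ c → (∃ λ d → d ⊏ A ∔ ρ × c ⊑ d ⊕ H) ⊎ (∃ λ d → d ⊏ H × c ⊑ (A ∔ ρ) ⊕ d) →
                  c ⊏ goal
          below c (inj₂ (η , η⊏H , c⊑)) = ⊑-⊏-trans c (A ∔ (ρ ⊕ η)) goal
            (⊑-trans c ((A ∔ ρ) ⊕ η) (A ∔ (ρ ⊕ η)) c⊑ (∔⊕-small (acc rs) mult ρ η ρ⊏H η⊏H))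
            (⊏-⊑-trans (A ∔ (ρ ⊕ η)) (A ∔ H) goal
              (∔-⊏ʳ A H (closed ρ η ρ⊏H η⊏H)) (a⊑a∔b (A ∔ H) ρ))
          below c (inj₁ (d , d⊏ , c⊑)) with ⊏-∔⁻ A ρ d d⊏
          ... | inj₂ (ρ′ , ρ′⊏ρ , d⊑) = ⊑-⊏-trans c ((A ∔ ρ′) ⊕ H) goal
            (⊑-trans c (d ⊕ H) ((A ∔ ρ′) ⊕ H) c⊑ (⊕-mono d (A ∔ ρ′) H H d⊑ (⊑-refl H)))
            (⊑-⊏-trans ((A ∔ ρ′) ⊕ H) ((A ∔ H) ∔ ρ′) goal
              (go (rsρ ρ′⊏ρ) (⊏-trans ρ′ ρ H ρ′⊏ρ ρ⊏H))
              (∔-⊏ʳ (A ∔ H) ρ ρ′⊏ρ))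
          ... | inj₁ d⊏A = ⊑-⊏-trans c (A ∔ σ) goal
            (⊑-trans c (d ⊕ H) (A ∔ σ) c⊑
              (⊑-trans (d ⊕ H) ((A′ ∔ σ) ⊕ H) (A ∔ σ)
                (⊕-mono d (A′ ∔ σ) H H bound (⊑-refl H))
                (⊑-trans ((A′ ∔ σ) ⊕ H) ((A′ ∔ H) ∔ σ) (A ∔ σ)
                  (∔⊕-commute (rs A′⊏A) multiple σ remainder⊏)
                  (∔-⊑ˡ (A′ ∔ H) A σ (mult A′ A′⊏A)))))
            (⊏-⊑-trans (A ∔ σ) (A ∔ H) goal (∔-⊏ʳ A H remainder⊏) (a⊑a∔b (A ∔ H) ρ))
            where
            open Division (divide d) renaming (quotient to A′; remainder to σ)
            A′⊏A = ⊑-⊏-trans A′ d A quotient⊑ d⊏A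

    Small : T → T → Set (Level.suc ℓ)
    Small β η = ∀ δ → δ ⊏ β → δ ⊕ η ⊏ β

    -- Here the Cantor normal form of `β` has at least two terms, and `H` is the last of them.
    record LastTerm (β : T) : Set (Level.suc ℓ) where
      constructor lastTerm
      field
        {G H} : T
        G⊏β   : G ⊏ β
        H⊏β   : H ⊏ β
        small : ∀ η → η ⊏ H → Small β η
        bound : β ⊑ G ∔ H

    -- The first alternative is the case of zero or a power of ω. Otherwise `H` is the least ordinal
    -- that is not small.
    split-last-term : ∀ β → (∀ η → η ⊏ β → Small β η) ⊎ LastTerm β
    split-last-term β with lem {P = ∃ λ η → η ⊏ β × ¬ Small β η}
    ... | no ¬∃ = inj₁ all-small
      where
      all-small : ∀ η → η ⊏ β → Small β η
      all-small η η⊏β with lem {P = Small β η}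
      ... | yes s = s
      ... | no ¬s = ⊥-elim (¬∃ (η , η⊏β , ¬s))
    ... | yes (η , η⊏β , ¬s) with least (λ H → H ⊏ β × ¬ Small β H) (η⊏β , ¬s)
    ...   | H , (H⊏β , ¬small-H) , H-least = inj₂ witness
      where
      small-below : ∀ η → η ⊏ H → Small β η
      small-below η η⊏H with lem {P = Small β η}
      ... | yes s = s
      ... | no ¬s = ⊥-elim (⊏⇒⋢ η H η⊏H (H-least η (⊏-trans η H β η⊏H H⊏β , ¬s)))

      closed : Closed H
      -- If `H ⊑ a ⊕ b`, then adding first `a` and then `b` to any `δ ⊏ β` stays below `β`, so `H`
      -- would be small.
      closed a b a⊏H b⊏H with ⊑-or-⊐ H (a ⊕ b)
      ... | inj₂ p = p
      ... | inj₁ H⊑a⊕b = ⊥-elim (¬small-H λ δ δ⊏β →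
        ⊑-⊏-trans (δ ⊕ H) ((δ ⊕ a) ⊕ b) β
          (⊑-trans (δ ⊕ H) (δ ⊕ (a ⊕ b)) ((δ ⊕ a) ⊕ b)
            (⊕-mono δ δ H (a ⊕ b) (⊑-refl δ) H⊑a⊕b) (⊕-assoc δ a b))
          (small-below b b⊏H (δ ⊕ a) (small-below a a⊏H δ δ⊏β)))

      nonempty : ∃ λ (c : T) → c ⊏ H
      nonempty with lem {P = ∃ λ (c : T) → c ⊏ H}
      ... | yes p = p
      ... | no ¬p = ⊥-elim (¬small-H λ δ δ⊏β →
        ⊑-⊏-trans (δ ⊕ H) δ β (⊕-zero δ H λ c c⊏H → ¬p (c , c⊏H)) δ⊏β)

      overflow : ∃ λ (δ : T) → δ ⊏ β × β ⊑ δ ⊕ H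
      overflow with lem {P = ∃ λ (δ : T) → δ ⊏ β × β ⊑ δ ⊕ H}
      ... | yes p = p
      ... | no ¬p = ⊥-elim (¬small-H λ δ δ⊏β →
        ⋢⇒⊐ β (δ ⊕ H) λ β⊑ → ¬p (δ , δ⊏β , β⊑))

      witness : LastTerm β
      witness with overflow
      ... | δ , δ⊏β , β⊑δ⊕H = choose (⊑-or-⊐ β (A ∔ H))
        where
        open Division (divide H closed nonempty δ) renaming (quotient to A; remainder to ρ)
        -- With δ divided as `A ∔ ρ`, the candidate for `G` is `A`. If `A ∔ H` is still below `β`,
        -- then it serves as `G` itself, since `β ⊑ δ ⊕ H ⊑ (A ∔ H) ∔ ρ`.
        choose : β ⊑ A ∔ H ⊎ A ∔ H ⊏ β → LastTerm β
        choose (inj₁ β⊑) = lastTerm (⊑-⊏-trans A δ β quotient⊑ δ⊏β) H⊏β small-below β⊑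
        choose (inj₂ A∔H⊏β) = lastTerm A∔H⊏β H⊏β small-below
          (⊑-trans β (δ ⊕ H) ((A ∔ H) ∔ H) β⊑δ⊕H
            (⊑-trans (δ ⊕ H) ((A ∔ ρ) ⊕ H) ((A ∔ H) ∔ H)
              (⊕-mono δ (A ∔ ρ) H H bound (⊑-refl H))
              (⊑-trans ((A ∔ ρ) ⊕ H) ((A ∔ H) ∔ ρ) ((A ∔ H) ∔ H)
                (∔⊕-commute H closed nonempty (⊏-wellFounded A) multiple
                  ρ remainder⊏)
                (∔-⊑ʳ (A ∔ H) ρ H (⊏⇒⊑ ρ H remainder⊏)))))

  -- Least elements and finite sets of natural numbers.

  leastℕ : ∀ {ℓ} (P : ℕ → Set ℓ) → ∃ P → ∃ λ n → P n × ∀ m → P m → n ℕ.≤ m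
  leastℕ P (n , pn) = go (<-wellFounded n) pn
    where
    go : ∀ {n} → Acc ℕ._<_ n → P n → ∃ λ n → P n × ∀ m → P m → n ℕ.≤ m
    go {n} (acc rs) pn with lem {P = ∃ λ m → P m × m ℕ.< n}
    ... | yes (m , pm , m<n) = go (rs m<n) pm
    ... | no ¬∃ = n , pn , λ m pm → ℕ.≮⇒≥ λ m<n → ¬∃ (m , pm , m<n)

  -- Finiteness as termination of removing points one at a time, which permits induction on the
  -- removal of a chosen point.
  data Finite (P : ℕ → Set) : Set₁ where
    fin : (∀ v → P v → Finite (λ y → P y × ¬ y ≡ v)) → Finite P

  finite-⊆ : ∀ {P Q} → Q ⊆ P → Finite P → Finite Q
  finite-⊆ Q⊆P (fin f) = fin λ v qv →
    finite-⊆ (λ (qy , y≢v) → Q⊆P qy , y≢v) (f v (Q⊆P qv))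

  finite-insert : ∀ {P Q} w → (∀ {y} → P y → ¬ y ≡ w → Q y) → Finite Q → Finite P
  finite-insert {P} w P⊆Q F@(fin f) = fin remove
    where
    remove : ∀ v → P v → Finite (λ y → P y × ¬ y ≡ v)
    remove v pv with v ℕ.≟ w
    ... | yes refl = finite-⊆ (λ (py , y≢w) → P⊆Q py y≢w) F
    ... | no v≢w = finite-insert w (λ (py , y≢v) y≢w → P⊆Q py y≢w , y≢v) (f v (P⊆Q pv v≢w))

  finite-bounded : ∀ N {P} → (∀ {y} → P y → y ℕ.< N) → Finite P
  finite-bounded zero P<0 = fin λ v pv → ⊥-elim (ℕ.n≮0 (P<0 pv))
  finite-bounded (suc N) P<1+N = finite-insert N _,_
    (finite-bounded N λ (py , y≢N) → ℕ.≤∧≢⇒< (ℕ.s≤s⁻¹ (P<1+N py)) y≢N)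

  -- The rank of the tree of bad sequences.

  module WellQuasi
    (_≤_ : ℕ → ℕ → Set) (≤-refl : Reflexive _≤_) (≤-trans : Transitive _≤_)
    (≤-antisym : Antisymmetric _≡_ _≤_)
    (no-bad : ∀ (b : ℕ → ℕ) → ¬ (∀ m n → m ℕ.< n → ¬ (b m ≤ b n)))
    where

    open Arithmetic {0ℓ}

    infixl 7 _∖_ _↾_

    _∖_ _↾_ : Pred ℕ 0ℓ → ℕ → Pred ℕ 0ℓ
    (S ∖ x) y = S y × ¬ (x ≤ y)
    (S ↾ x) y = S y × x ≤ y

    -- Well-foundedness of the tree of bad sequences in `S`: after `x`, the sequence continues
    -- inside `S ∖ x`.
    data WQ (S : Pred ℕ 0ℓ) : Set₁ where
      wq : (∀ x → S x → WQ (S ∖ x)) → WQ S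

    ¬WQ-step : ∀ {S} → ¬ WQ S → ∃ λ x → S x × ¬ WQ (S ∖ x)
    ¬WQ-step {S} ¬w = by-contradiction λ ¬∃ →
      ¬w (wq λ x sx → by-contradiction λ ¬wx → ¬∃ (x , sx , ¬wx))

    -- Where `WQ` fails, it fails again in `S ∖ x` for some `x`; iterating the choice of `x`
    -- produces an infinite bad sequence.
    wellQuasi : ∀ S → WQ S
    wellQuasi S = by-contradiction λ ¬w → no-bad (term ¬w) (term-bad ¬w)
      where
      stage : ¬ WQ S → ℕ → ∃ λ T → ¬ WQ T
      next : (∃ λ T → ¬ WQ T) → ∃ λ T → ¬ WQ T
      next (T , ¬w) = T ∖ proj₁ (¬WQ-step ¬w) , proj₂ (proj₂ (¬WQ-step ¬w))
      stage ¬w zero = S , ¬w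
      stage ¬w (suc n) = next (stage ¬w n)

      term : ¬ WQ S → ℕ → ℕ
      term ¬w n = proj₁ (¬WQ-step (proj₂ (stage ¬w n)))

      stage-⊆ : ∀ ¬w {m n} → m ℕ.≤′ n → proj₁ (stage ¬w n) ⊆ proj₁ (stage ¬w m)
      stage-⊆ ¬w (ℕ.≤′-reflexive refl) = id
      stage-⊆ ¬w (ℕ.≤′-step m≤n) = stage-⊆ ¬w m≤n ∘ proj₁

      term-bad : ∀ ¬w m n → m ℕ.< n → ¬ (term ¬w m ≤ term ¬w n)
      term-bad ¬w m n m<n = proj₂ (stage-⊆ ¬w (ℕ.≤⇒≤′ m<n)
        (proj₁ (proj₂ (¬WQ-step (proj₂ (stage ¬w n))))))

    o : ∀ {S} → WQ S → Tree 0ℓ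
    o {S} (wq f) = node {I = ∃ S} λ (x , sx) → o (f x sx)

    -- The case of equal sets shows that `o` depends on the set alone and not on the proof of `WQ`.
    o-mono : ∀ {S T} (v : WQ S) (w : WQ T) → S ⊆ T → o v ⊑ o w
    o-mono (wq f) (wq g) S⊆T (x , sx) =
      (x , S⊆T sx) , o-mono (f x sx) (g x (S⊆T sx)) λ (sy , x≰y) → S⊆T sy , x≰y

    ⊏-o⁻ : ∀ {S} (w : WQ S) {γ : Tree 0ℓ} → γ ⊏ o w →
           ∃ λ x → S x × ∀ (v : WQ (S ∖ x)) → γ ⊑ o v
    ⊏-o⁻ (wq f) {γ} ((x , sx) , p) =
      x , sx , λ v → ⊑-trans γ (o (f x sx)) (o v) p (o-mono (f x sx) v id)

    ⊏-o : ∀ {S} (w : WQ S) {γ : Tree 0ℓ} {x} → S x → (v : WQ (S ∖ x)) → γ ⊑ o v → γ ⊏ o w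
    ⊏-o (wq f) {γ} {x} sx v p =
      (x , sx) , ⊑-trans γ (o v) (o (f x sx)) p (o-mono v (f x sx) id)

    -- Each point of a bad sequence is charged to a part that contains it. This lowers the summand
    -- of that part and leaves the other in place, as the natural sum allows.
    o-∪ : ∀ {S D U} (w : WQ S) (u : WQ D) (v : WQ U) →
          (∀ {y} → S y → D y ⊎ U y) → o w ⊑ o u ⊕ o v
    o-∪ (wq f) u@(wq g) v@(wq h) cover (x , sx) with cover sx
    ... | inj₁ dx = inj₁ (x , dx) , o-∪ (f x sx) (g x dx) v
      λ (sy , x≰y) → [ (λ dy → inj₁ (dy , x≰y)) , inj₂ ]′ (cover sy)
    ... | inj₂ ux = inj₂ (x , ux) , o-∪ (f x sx) u (h x ux)
      λ (sy , x≰y) → [ inj₁ , (λ uy → inj₂ (uy , x≰y)) ]′ (cover sy)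

    -- Deleting `v` costs at most one. If the first point is `v`, then `T ∖ v` lacks `v` anyway;
    -- otherwise the cost is passed on to a child of `γ`.
    o-remove : ∀ {T} v (γ : Tree 0ℓ) → γ ⊏ o (wellQuasi T) →
               γ ⊑ o (wellQuasi λ y → T y × ¬ y ≡ v)
    o-remove {T} v γ γ⊏ with ⊏-o⁻ (wellQuasi T) {γ} γ⊏
    o-remove {T} v γ@(node g) γ⊏ | x , tx , γ⊑ with x ℕ.≟ v
    ... | yes refl = ⊑-trans γ (o (wellQuasi (T ∖ x))) _ (γ⊑ _)
      (o-mono (wellQuasi (T ∖ x)) (wellQuasi _)
        λ { (ty , x≰y) → ty , λ { refl → x≰y ≤-refl } })
    ... | no x≢v = ⊑-build γ (o (wellQuasi _)) below
      where
      T-v = λ y → T y × ¬ y ≡ v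
      below : ∀ (c : Tree 0ℓ) → c ⊏ γ → c ⊏ o (wellQuasi T-v)
      below c (i , c⊑gi) = ⊑-⊏-trans c (g i) (o (wellQuasi T-v)) c⊑gi
        (⊏-o (wellQuasi T-v) {g i} (tx , x≢v) (wellQuasi (T-v ∖ x))
          (⊑-trans (g i) (o (wellQuasi _)) (o (wellQuasi (T-v ∖ x)))
            (o-remove {T ∖ x} v (g i)
              (⊏-⊑-trans (g i) γ (o (wellQuasi (T ∖ x))) (child g i) (γ⊑ _)))
            (o-mono (wellQuasi _) (wellQuasi (T-v ∖ x))
              λ ((ty , x≰y) , y≢v) → (ty , y≢v) , x≰y)))

    Maximal : Pred ℕ 0ℓ → Pred ℕ 0ℓ
    Maximal P v = P v × ∀ {y} → P y → v ≤ y → y ≡ v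

    maximal-above : ∀ {P} → Finite P → ∀ {v} → P v → ∃ λ m → Maximal P m × v ≤ m
    maximal-above {P} (fin f) {v} pv with lem {P = ∃ λ y → P y × ¬ y ≡ v × v ≤ y}
    ... | no ¬∃ = v , (pv , λ {y} py v≤y →
      by-contradiction λ y≢v → ¬∃ (y , py , y≢v , v≤y)) , ≤-refl
    ... | yes (y , py , y≢v , v≤y) with maximal-above (f v pv) (py , y≢v)
    ...   | m , ((pm , m≢v) , m-max) , y≤m = m , (pm , max) , ≤-trans v≤y y≤m
      where
      max : ∀ {z} → P z → m ≤ z → z ≡ m
      max {z} pz m≤z = m-max
        (pz , λ { refl → y≢v (≤-antisym (≤-trans y≤m m≤z) v≤y) }) m≤z

    -- Induction on the points of T above t: take a maximal one, v.  Removing v from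
    -- T lowers o by at most one, and v can be put back last.
    o-insert : ∀ {T t Q} → ¬ T t → T ↾ t ⊆ Q → Finite Q → (γ : Tree 0ℓ) → γ ⊑ o (wellQuasi T) →
               γ ⊏ o (wellQuasi λ y → T y ⊎ y ≡ t)
    o-insert {T} {t} ¬tt ⊆Q F@(fin f) γ γ⊑ with lem {P = ∃ (T ↾ t)}
    ... | no ¬∃ = ⊏-o (wellQuasi _) {γ} {t} (inj₂ refl) (wellQuasi _)
      (⊑-trans γ (o (wellQuasi T)) _ γ⊑
        (o-mono (wellQuasi T) (wellQuasi _) λ {y} ty → inj₁ ty , λ t≤y → ¬∃ (y , ty , t≤y)))
    ... | yes (v₀ , tv₀) with maximal-above (finite-⊆ ⊆Q F) tv₀
    ...   | v , ((tv , t≤v) , v-max) , _ =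
      ⊏-o (wellQuasi _) {γ} {v} (inj₁ tv) (wellQuasi _) (⊑-build γ (o (wellQuasi _)) below)
      where
      T+t T-v T-v+t : Pred ℕ 0ℓ
      T+t y = T y ⊎ y ≡ t
      T-v y = T y × ¬ y ≡ v
      T-v+t y = T-v y ⊎ y ≡ t

      T-v+t⊆ : T-v+t ⊆ T+t ∖ v
      T-v+t⊆ (inj₁ (ty , y≢v)) = inj₁ ty , λ v≤y → y≢v (v-max (ty , ≤-trans t≤v v≤y) v≤y)
      T-v+t⊆ (inj₂ refl) = inj₂ refl , λ v≤t →
        ¬tt (subst T (≤-antisym v≤t t≤v) tv)

      below : ∀ (c : Tree 0ℓ) → c ⊏ γ → c ⊏ o (wellQuasi (T+t ∖ v))
      below c c⊏γ = ⊏-⊑-trans c (o (wellQuasi T-v+t)) (o (wellQuasi (T+t ∖ v)))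
        (o-insert {T-v} {t} (¬tt ∘ proj₁)
          (λ ((ty , y≢v) , t≤y) → ⊆Q (ty , t≤y) , y≢v) (f v (⊆Q (tv , t≤v)))
          c (o-remove v c (⊏-⊑-trans c γ (o (wellQuasi T)) c⊏γ γ⊑)))
        (o-mono (wellQuasi T-v+t) (wellQuasi (T+t ∖ v)) T-v+t⊆)

    -- Realising ordinals by bad-free transfinite sequences: the de Jongh-Parikh theorem.

    -- The values of h outside β are irrelevant, and h need not respect equality of
    -- ordinals.
    Realises : Tree 0ℓ → Pred ℕ 0ℓ → Set₁
    Realises β S = ∃ λ (h : Tree 0ℓ → ℕ) →
      (∀ γ → γ ⊏ β → S (h γ)) × (∀ γ γ′ → γ ⊏ γ′ → γ′ ⊏ β → ¬ (h γ′ ≤ h γ))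

    realises-⊆ : ∀ {β S T} → S ⊆ T → Realises β S → Realises β T
    realises-⊆ S⊆T (h , h∈S , good) = h , (λ γ γ⊏β → S⊆T (h∈S γ γ⊏β)) , good

    -- Ordinals below `G` take their values in `D`, the others take values in `U` according to their
    -- left difference with `G`. Pairs across the two parts are settled by the separation
    -- hypothesis.
    concatenate : ∀ {β G H D U} → β ⊑ G ∔ H → (∀ {x y} → D x → U y → ¬ (y ≤ x)) →
                  Realises G D → Realises H U → Realises β (λ y → D y ⊎ U y)
    concatenate {β} {G} {H} {D} {U} β⊑ sep (h , h∈ , h-good) (k , k∈ , k-good) =
      -- Decisions are passed as arguments so that the proofs about `value` can match on them.
      (λ γ → value γ (lem {P = γ ⊏ G})) ,
      (λ γ γ⊏β → value∈ γ γ⊏β lem) ,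
      (λ γ γ′ γ⊏γ′ γ′⊏β → good γ γ′ γ⊏γ′ γ′⊏β lem lem)
      where
      -- Left subtraction: for `γ` between `G` and `β`, this is the ρ with G + ρ = γ.
      Difference : Tree 0ℓ → Tree 0ℓ → Set₁
      Difference γ ρ = γ ⊑ G ∔ ρ × ∀ c → γ ⊑ G ∔ c → ρ ⊑ c

      minus : ∀ γ → Dec (∃ (Difference γ)) → Tree 0ℓ
      minus γ (yes (ρ , _)) = ρ
      -- A default, never reached for `γ ⊏ β` outside `G`.
      minus γ (no _) = γ

      value : ∀ γ → Dec (γ ⊏ G) → ℕ
      value γ (yes _) = h γ
      value γ (no _) = k (minus γ lem)

      minus-spec : ∀ γ → γ ⊏ β → ¬ (γ ⊏ G) → (d : Dec (∃ (Difference γ))) →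
                   minus γ d ⊏ H × γ ⊑ G ∔ minus γ d × G ∔ minus γ d ⊑ γ
      minus-spec γ γ⊏β ¬γ⊏G d with ⊏-∔⁻ G H γ (⊏-⊑-trans γ β (G ∔ H) γ⊏β β⊑)
      ... | inj₁ γ⊏G = ⊥-elim (¬γ⊏G γ⊏G)
      ... | inj₂ (η , η⊏H , γ⊑G∔η) with d
      ...   | no ¬∃ = ⊥-elim (¬∃ (least (λ ρ → γ ⊑ G ∔ ρ) γ⊑G∔η))
      ...   | yes (ρ , γ⊑ , ρ-least) =
        ⊑-⊏-trans ρ η H (ρ-least η γ⊑G∔η) η⊏H , γ⊑ , ⊑-build (G ∔ ρ) γ below
        where
        below : ∀ c → c ⊏ G ∔ ρ → c ⊏ γ
        below c c⊏ with ⊏-∔⁻ G ρ c c⊏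
        ... | inj₁ c⊏G = ⊏-⊑-trans c G γ c⊏G (⊏̸⇒⊒ γ G ¬γ⊏G)
        ... | inj₂ (σ , σ⊏ρ , c⊑) = ⊑-⊏-trans c (G ∔ σ) γ c⊑
          (⋢⇒⊐ γ (G ∔ σ) λ γ⊑G∔σ → ⊏⇒⋢ σ ρ σ⊏ρ (ρ-least σ γ⊑G∔σ))

      value∈ : ∀ γ → γ ⊏ β → (d : Dec (γ ⊏ G)) → D (value γ d) ⊎ U (value γ d)
      value∈ γ γ⊏β (yes γ⊏G) = inj₁ (h∈ γ γ⊏G)
      value∈ γ γ⊏β (no ¬γ⊏G) = inj₂ (k∈ _ (proj₁ (minus-spec γ γ⊏β ¬γ⊏G lem)))

      good : ∀ γ γ′ → γ ⊏ γ′ → γ′ ⊏ β → (d : Dec (γ ⊏ G)) (d′ : Dec (γ′ ⊏ G)) →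
             ¬ (value γ′ d′ ≤ value γ d)
      good γ γ′ γ⊏γ′ γ′⊏β (yes γ⊏G) (yes γ′⊏G) = h-good γ γ′ γ⊏γ′ γ′⊏G
      good γ γ′ γ⊏γ′ γ′⊏β (yes γ⊏G) (no ¬γ′⊏G) =
        sep (h∈ γ γ⊏G) (k∈ _ (proj₁ (minus-spec γ′ γ′⊏β ¬γ′⊏G lem)))
      good γ γ′ γ⊏γ′ γ′⊏β (no ¬γ⊏G) (yes γ′⊏G) = ⊥-elim (¬γ⊏G (⊏-trans γ γ′ G γ⊏γ′ γ′⊏G))
      good γ γ′ γ⊏γ′ γ′⊏β (no ¬γ⊏G) (no ¬γ′⊏G) = k-good ρ ρ′ ρ⊏ρ′ (proj₁ spec′)
        where
        ρ  = minus γ lem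
        ρ′ = minus γ′ lem
        spec  = minus-spec γ (⊏-trans γ γ′ β γ⊏γ′ γ′⊏β) ¬γ⊏G lem
        spec′ = minus-spec γ′ γ′⊏β ¬γ′⊏G lem
        ρ⊏ρ′ : ρ ⊏ ρ′
        ρ⊏ρ′ = ⋢⇒⊐ ρ′ ρ λ ρ′⊑ρ → ⊏⇒⋢ γ γ′ γ⊏γ′
          (⊑-trans γ′ (G ∔ ρ′) γ (proj₁ (proj₂ spec′))
            (⊑-trans (G ∔ ρ′) (G ∔ ρ) γ (∔-⊑ʳ G ρ′ ρ ρ′⊑ρ) (proj₂ (proj₂ spec))))

    -- Layer n lies above `point n` but not above `point (suc n)`, so no element of a later layer is
    -- below one of an earlier layer. Each `γ` goes to the first layer whose bound exceeds it, hence
    -- a larger ordinal never goes to an earlier layer.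
    module Layers
      {β : Tree 0ℓ} {S : Pred ℕ 0ℓ} (x₀ : ∃ S)
      (bound : ℕ → Tree 0ℓ) (cofinal : ∀ (γ : Tree 0ℓ) → γ ⊏ β → ∃ λ n → γ ⊏ bound n)
      (layer : ∀ n ((x , _) : ∃ S) → ∃ λ y → (S ↾ x) y × Realises (bound n) (S ↾ x ∖ y))
      where

      point : ℕ → ∃ S
      point zero = x₀
      point (suc n) = let y , (sy , _) , _ = layer n (point n) in y , sy

      point-mono : ∀ {m n} → m ℕ.≤′ n → proj₁ (point m) ≤ proj₁ (point n)
      point-mono (ℕ.≤′-reflexive refl) = ≤-refl
      point-mono (ℕ.≤′-step {n} m≤n) =
        ≤-trans (point-mono m≤n) (proj₂ (proj₁ (proj₂ (layer n (point n)))))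

      realisation : ∀ n → Realises (bound n) (S ↾ proj₁ (point n) ∖ proj₁ (point (suc n)))
      realisation n = proj₂ (proj₂ (layer n (point n)))

      LayerOf : Tree 0ℓ → ℕ → Set
      LayerOf γ n = γ ⊏ bound n × ∀ m → γ ⊏ bound m → n ℕ.≤ m

      value : ∀ γ → Dec (∃ (LayerOf γ)) → ℕ
      value γ (yes (n , _)) = proj₁ (realisation n) γ
      value γ (no _) = 0

      level : ∀ γ → γ ⊏ β → ∃ (LayerOf γ)
      level γ γ⊏β = leastℕ (λ n → γ ⊏ bound n) (cofinal γ γ⊏β)

      value∈ : ∀ γ → γ ⊏ β → (d : Dec (∃ (LayerOf γ))) → S (value γ d)
      value∈ γ γ⊏β (no ¬∃) = ⊥-elim (¬∃ (level γ γ⊏β))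
      value∈ γ γ⊏β (yes (n , γ⊏ , _)) = proj₁ (proj₁ (proj₁ (proj₂ (realisation n)) γ γ⊏))

      good : ∀ γ γ′ → γ ⊏ γ′ → γ′ ⊏ β → (d : Dec (∃ (LayerOf γ))) (d′ : Dec (∃ (LayerOf γ′))) →
             ¬ (value γ′ d′ ≤ value γ d)
      good γ γ′ γ⊏γ′ γ′⊏β (no ¬∃) d′ = ⊥-elim (¬∃ (level γ (⊏-trans γ γ′ β γ⊏γ′ γ′⊏β)))
      good γ γ′ γ⊏γ′ γ′⊏β (yes _) (no ¬∃) = ⊥-elim (¬∃ (level γ′ γ′⊏β))
      good γ γ′ γ⊏γ′ γ′⊏β (yes (n , γ⊏ , n-least)) (yes (n′ , γ′⊏ , _))
        with ℕ.<-cmp n n′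
      ... | tri≈ _ refl _ = proj₂ (proj₂ (realisation n)) γ γ′ γ⊏γ′ γ′⊏
      ... | tri> _ _ n′<n =
        ⊥-elim (ℕ.<⇒≱ n′<n (n-least n′ (⊏-trans γ γ′ (bound n′) γ⊏γ′ γ′⊏)))
      ... | tri< n<n′ _ _ = λ y≤x →
        proj₂ (proj₁ (proj₂ (realisation n)) γ γ⊏)
          (≤-trans (point-mono (ℕ.≤⇒≤′ n<n′))
            (≤-trans (proj₂ (proj₁ (proj₁ (proj₂ (realisation n′)) γ′ γ′⊏))) y≤x))

      realises : Realises β S
      realises = (λ γ → value γ lem) , (λ γ γ⊏β → value∈ γ γ⊏β lem) ,
                 (λ γ γ′ γ⊏γ′ γ′⊏β → good γ γ′ γ⊏γ′ γ′⊏β lem lem)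

    -- Replace `S` by `S ∖ x` as long as the rank stays at least `β`; this stops because the tree of
    -- bad sequences is well founded.
    shrink : ∀ {β : Tree 0ℓ} {S} (w : WQ S) → β ⊑ o w →
             ∃ λ T → T ⊆ S × β ⊑ o (wellQuasi T) × ∀ {x} → T x → o (wellQuasi (T ∖ x)) ⊏ β
    shrink {β} {S} w@(wq f) β⊑ with lem {P = ∃ λ x → Σ (S x) λ sx → β ⊑ o (f x sx)}
    ... | yes (x , sx , β⊑′) =
      let T , T⊆ , rest = shrink {β} (f x sx) β⊑′ in T , proj₁ ∘ T⊆ , rest
    ... | no ¬∃ = S , id , ⊑-trans β (o w) _ β⊑ (o-mono w (wellQuasi S) id) , λ {x} sx →
      ⋢⇒⊐ β _ λ p → ¬∃ (x , sx , ⊑-trans β _ (o (f x sx)) p (o-mono _ (f x sx) id))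

    realise : ∀ {β} → Acc _⊏_ β → ∀ {S} → β ⊑ o (wellQuasi S) → Realises β S
    realise {β} (acc rs) {S₀} β⊑o with shrink {β} (wellQuasi S₀) β⊑o
    ... | S , S⊆S₀ , β⊑ , lower = realises-⊆ {β} {S} S⊆S₀
      (cases (lem {P = ∃ λ γ → γ ⊏ β × ∀ δ → δ ⊏ β → δ ⊑ γ}) (split-last-term β))
      where
      w = wellQuasi S

      -- β ⊑ o (S ∖ x) ⊕ o (S ↾ x), and the first summand lies below β.
      upper-large : ∀ {H} x → S x → (∀ η → η ⊏ H → Small β η) → H ⊑ o (wellQuasi (S ↾ x))
      upper-large {H} x sx small = ⊏̸⇒⊒ (o (wellQuasi (S ↾ x))) H λ η⊏H →
        ⊏-irrefl β (⊑-⊏-trans β (o (wellQuasi (S ∖ x)) ⊕ o (wellQuasi (S ↾ x))) β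
          (⊑-trans β (o w) _ β⊑ (o-∪ w (wellQuasi (S ∖ x)) (wellQuasi (S ↾ x)) cover))
          (small _ η⊏H _ (lower sx)))
        where
        cover : ∀ {y} → S y → (S ∖ x) y ⊎ (S ↾ x) y
        cover {y} sy with lem {P = x ≤ y}
        ... | yes x≤y = inj₂ (sy , x≤y)
        ... | no x≰y = inj₁ (sy , x≰y)

      cases : Dec (∃ λ γ → γ ⊏ β × ∀ δ → δ ⊏ β → δ ⊑ γ) →
              (∀ η → η ⊏ β → Small β η) ⊎ LastTerm β → Realises β S
      -- Successor case: `x` becomes the last value, after a realisation of the predecessor `γ`
      -- among the points not above `x`.
      cases (yes (γ , γ⊏β , γ-greatest)) _ = snoc (⊏-o⁻ w {γ} (⊏-⊑-trans γ β (o w) γ⊏β β⊑))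
        where
        snoc : (∃ λ x → S x × ∀ (v : WQ (S ∖ x)) → γ ⊑ o v) → Realises β S
        snoc (x , sx , γ⊑) = (λ ξ → value ξ lem) , (λ ξ _ → value∈ ξ lem) ,
          (λ ξ ξ′ ξ⊏ξ′ ξ′⊏β → good ξ ξ′ ξ⊏ξ′ ξ′⊏β lem lem)
          where
          init : Realises γ (S ∖ x)
          init = realise (rs γ⊏β) (γ⊑ _)
          h = proj₁ init
          value : ∀ ξ → Dec (ξ ⊏ γ) → ℕ
          value ξ (yes _) = h ξ
          value ξ (no _) = x
          value∈ : ∀ ξ d → S (value ξ d)
          value∈ ξ (yes ξ⊏γ) = proj₁ (proj₁ (proj₂ init) ξ ξ⊏γ)
          value∈ ξ (no _) = sx
          good : ∀ ξ ξ′ → ξ ⊏ ξ′ → ξ′ ⊏ β → (d : Dec (ξ ⊏ γ)) (d′ : Dec (ξ′ ⊏ γ)) →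
                 ¬ (value ξ′ d′ ≤ value ξ d)
          good ξ ξ′ ξ⊏ξ′ ξ′⊏β (no ¬p) _ =
            ⊥-elim (¬p (⊏-⊑-trans ξ ξ′ γ ξ⊏ξ′ (γ-greatest ξ′ ξ′⊏β)))
          good ξ ξ′ ξ⊏ξ′ ξ′⊏β (yes ξ⊏γ) (yes ξ′⊏γ) = proj₂ (proj₂ init) ξ ξ′ ξ⊏ξ′ ξ′⊏γ
          good ξ ξ′ ξ⊏ξ′ ξ′⊏β (yes ξ⊏γ) (no _) = proj₂ (proj₁ (proj₂ init) ξ ξ⊏γ)
      cases (no _) (inj₂ (lastTerm {G} {H} G⊏β H⊏β small β⊑G∔H)) =
        join (⊏-o⁻ w {G} (⊏-⊑-trans G β (o w) G⊏β β⊑))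
        where
        join : (∃ λ x → S x × ∀ (v : WQ (S ∖ x)) → G ⊑ o v) → Realises β S
        join (x , sx , G⊑) = realises-⊆ {β} {λ y → (S ∖ x) y ⊎ (S ↾ x) y} [ proj₁ , proj₁ ]′
          (concatenate {β} {G} {H} {S ∖ x} {S ↾ x} β⊑G∔H
            (λ (_ , x≰d) (_ , x≤u) u≤d → x≰d (≤-trans x≤u u≤d))
            (realise (rs G⊏β) (G⊑ _))
            (realise (rs H⊏β) (upper-large {H} x sx small)))
      cases (no limit) (inj₁ small) with lem {P = ∃ λ γ → γ ⊏ β}
      ... | no empty = (λ _ → 0) , (λ γ γ⊏β → ⊥-elim (empty (γ , γ⊏β))) ,
                       (λ _ γ γ⊏γ′ γ⊏β → ⊥-elim (empty (γ , γ⊏β)))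
      ... | yes (γ₀ , γ₀⊏β) = Layers.realises x₀ (λ n → bound n lem) cofinal layer
        where
        x₀ : ∃ S
        x₀ = let x , sx , _ = ⊏-o⁻ w {γ₀} (⊏-⊑-trans γ₀ β (o w) γ₀⊏β β⊑) in x , sx

        -- The ranks of `S ∖ n` for `n` in `S` are cofinal in `β` because `β ⊑ o w`. Other indices
        -- receive the harmless value `γ₀ ⊏ β`.
        bound : ∀ n → Dec (S n) → Tree 0ℓ
        bound n (yes _) = o (wellQuasi (S ∖ n))
        bound n (no _) = γ₀

        bound⊏ : ∀ n d → bound n d ⊏ β
        bound⊏ n (yes sn) = lower sn
        bound⊏ n (no _) = γ₀⊏β

        cofinal : ∀ γ → γ ⊏ β → ∃ λ n → γ ⊏ bound n lem
        cofinal γ γ⊏β with lem {P = ∃ λ δ → δ ⊏ β × γ ⊏ δ}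
        ... | no ¬δ = ⊥-elim (limit (γ , γ⊏β , λ δ δ⊏β →
          ⊏̸⇒⊒ γ δ λ γ⊏δ → ¬δ (δ , δ⊏β , γ⊏δ)))
        ... | yes (δ , δ⊏β , γ⊏δ) with ⊏-o⁻ w {δ} (⊏-⊑-trans δ β (o w) δ⊏β β⊑)
        ...   | x , sx , δ⊑ = x , above lem
          where
          above : (d : Dec (S x)) → γ ⊏ bound x d
          above (yes _) = ⊏-⊑-trans γ δ _ γ⊏δ (δ⊑ _)
          above (no ¬sx) = ⊥-elim (¬sx sx)

        layer : ∀ n ((x , _) : ∃ S) → ∃ λ y → (S ↾ x) y × Realises (bound n lem) (S ↾ x ∖ y)
        layer n (x , sx) =
          let c = bound n lem
              y , sy , c⊑ = ⊏-o⁻ (wellQuasi (S ↾ x)) {c}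
                (⊏-⊑-trans c β _ (bound⊏ n lem) (upper-large {β} x sx small))
          in y , sy , realise (rs (bound⊏ n lem)) (c⊑ _)

  -- Ranks in well-orders and embeddings onto initial segments.

  module Rank {a ℓ₁ ℓ₂} (α : Ordinal a ℓ₁ ℓ₂) where
    open Ordinal α renaming (refl to ≤-refl; trans to ≤-trans) public

    infix 4 _<_
    _<_ : Rel Carrier (ℓ₁ ⊔ ℓ₂)
    _<_ = Strict._<_ _≈_ _≤_

    <-≤-trans : ∀ {x y z} → x < y → y ≤ z → x < z
    <-≤-trans = Strict.<-≤-trans _≈_ _≤_ Eq.sym ≤-trans antisym ≤-respʳ-≈

    ≤-<-trans : ∀ {x y z} → x ≤ y → y < z → x < z
    ≤-<-trans = Strict.≤-<-trans _≈_ _≤_ ≤-trans antisym ≤-respˡ-≈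

    <-irrefl : ∀ {x} → ¬ (x < x)
    <-irrefl (_ , x≉x) = x≉x Eq.refl

    <⇒≱ : ∀ {x y} → x < y → ¬ (y ≤ x)
    <⇒≱ x<y y≤x = <-irrefl (<-≤-trans x<y y≤x)

    ≰⇒> : ∀ {x y} → ¬ (x ≤ y) → y < x
    ≰⇒> {x} {y} x≰y with total x y
    ... | inj₁ x≤y = ⊥-elim (x≰y x≤y)
    ... | inj₂ y≤x = y≤x , λ y≈x → x≰y (reflexive (Eq.sym y≈x))

    rankAcc : ∀ {x} → Acc _<_ x → Tree (a ⊔ ℓ₁ ⊔ ℓ₂)
    rankAcc {x} (acc rs) = node {I = ∃ (_< x)} λ (y , y<x) → rankAcc (rs y<x)

    rankAcc-mono : ∀ {x y} (p : Acc _<_ x) (q : Acc _<_ y) → x ≤ y → rankAcc p ⊑ rankAcc q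
    rankAcc-mono (acc rs) (acc ss) x≤y (z , z<x) =
      let z<y = <-≤-trans z<x x≤y in (z , z<y) , rankAcc-mono (rs z<x) (ss z<y) ≤-refl

    rank : Carrier → Tree (a ⊔ ℓ₁ ⊔ ℓ₂)
    rank x = rankAcc (wellFounded x)

    rank-mono : ∀ {x y} → x ≤ y → rank x ⊑ rank y
    rank-mono = rankAcc-mono _ _

    ⊏-rank⁻ : ∀ {ℓ} {γ : Tree ℓ} {x} → γ ⊏ rank x → ∃ λ y → y < x × γ ⊑ rank y
    ⊏-rank⁻ {γ = γ} {x} p with wellFounded x
    ... | acc rs = let (y , y<x) , γ⊑ = p in
      y , y<x , ⊑-trans γ (rankAcc (rs y<x)) (rank y) γ⊑ (rankAcc-mono _ _ ≤-refl)

    rank-< : ∀ {x y} → x < y → rank x ⊏ rank y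
    rank-< {x} {y} x<y with wellFounded y
    ... | acc rs = (x , x<y) , rankAcc-mono _ _ ≤-refl

    rank-⊑⁻ : ∀ {x y} → rank x ⊑ rank y → x ≤ y
    rank-⊑⁻ {x} {y} p = by-contradiction λ x≰y → ⊏⇒⋢ (rank y) (rank x) (rank-< (≰⇒> x≰y)) p

    -- Ranks form an initial segment of the ordinals: descend from `x` as long as `γ` is strictly
    -- below the rank reached.
    rank-fill : ∀ {ℓ} {γ : Tree ℓ} {x} → Acc _<_ x → γ ⊑ rank x →
                ∃ λ y → γ ⊑ rank y × rank y ⊑ γ
    rank-fill {γ = γ} {x} (acc rs) γ⊑ with ⊑-or-⊐ (rank x) γ
    ... | inj₁ ⊑γ = x , γ⊑ , ⊑γ
    ... | inj₂ γ⊏ = let y , y<x , γ⊑y = ⊏-rank⁻ {γ = γ} γ⊏ in rank-fill {γ = γ} (rs y<x) γ⊑y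

  module _ {b ℓ₁ ℓ₂ a ℓ₃ ℓ₄} (β : Ordinal b ℓ₁ ℓ₂) (α : Ordinal a ℓ₃ ℓ₄) where
    private
      module β = Rank β
      module α = Rank α

    -- The image of `k` may have gaps. Since the rank of `x` is at most that of `k x`, some element
    -- of α has exactly the rank of `x`, and `x` is sent there.
    strict⇒≼ : (k : β.Carrier → α.Carrier) → (∀ {x y} → x β.< y → k x α.< k y) → β ≼ α
    strict⇒≼ k k-mono = to , record
      { isOrderHomomorphism = record
        { cong = λ x≈y → α.antisym (mono (β.reflexive x≈y)) (mono (β.reflexive (β.Eq.sym x≈y)))
        ; mono = mono
        }
      ; injective = λ fx≈fy →
          β.antisym (cancel (α.reflexive fx≈fy)) (cancel (α.reflexive (α.Eq.sym fx≈fy)))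
      ; cancel = cancel
      } , initial
      where
      rank-k : ∀ {x} → Acc β._<_ x → β.rank x ⊑ α.rank (k x)
      rank-k {x} (acc rs) = ⊑-build (β.rank x) (α.rank (k x)) λ c c⊏ →
        let y , y<x , c⊑ = β.⊏-rank⁻ {γ = c} c⊏ in
        ⊑-⊏-trans c (β.rank y) (α.rank (k x)) c⊑
          (⊑-⊏-trans (β.rank y) (α.rank (k y)) (α.rank (k x)) (rank-k (rs y<x))
            (α.rank-< (k-mono y<x)))

      image : ∀ x → ∃ λ y → β.rank x ⊑ α.rank y × α.rank y ⊑ β.rank x
      image x = α.rank-fill {γ = β.rank x} (α.wellFounded (k x)) (rank-k (β.wellFounded x))

      to : β.Carrier → α.Carrier
      to x = proj₁ (image x)

      ⊑to : ∀ x → β.rank x ⊑ α.rank (to x)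
      ⊑to x = proj₁ (proj₂ (image x))

      to⊑ : ∀ x → α.rank (to x) ⊑ β.rank x
      to⊑ x = proj₂ (proj₂ (image x))

      mono : ∀ {x y} → x β.≤ y → to x α.≤ to y
      mono {x} {y} x≤y = α.rank-⊑⁻
        (⊑-trans (α.rank (to x)) (β.rank x) (α.rank (to y)) (to⊑ x)
          (⊑-trans (β.rank x) (β.rank y) (α.rank (to y)) (β.rank-mono x≤y) (⊑to y)))

      cancel : ∀ {x y} → to x α.≤ to y → x β.≤ y
      cancel {x} {y} fx≤fy = β.rank-⊑⁻
        (⊑-trans (β.rank x) (α.rank (to x)) (β.rank y) (⊑to x)
          (⊑-trans (α.rank (to x)) (α.rank (to y)) (β.rank y) (α.rank-mono fx≤fy) (to⊑ y)))

      initial : ∀ x y → y α.≤ to x → ∃[ x′ ] to x′ α.≈ y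
      initial x y y≤fx =
        let z , y⊑z , z⊑y = β.rank-fill {γ = α.rank y} (β.wellFounded x)
              (⊑-trans (α.rank y) (α.rank (to x)) (β.rank x) (α.rank-mono y≤fx) (to⊑ x))
        in z , α.antisym
          (α.rank-⊑⁻ (⊑-trans (α.rank (to z)) (β.rank z) (α.rank y) (to⊑ z) z⊑y))
          (α.rank-⊑⁻ (⊑-trans (α.rank y) (β.rank z) (α.rank (to z)) y⊑z (⊑to z)))

  -- Bad sequences and linear extensions of well partial orders.

  no-bad : ∀ {a ℓ₁ ℓ₂} {A : Set a} {_≈_ : Rel A ℓ₁} {_≤_ : Rel A ℓ₂} → IsWPO _≈_ _≤_ →
           ∀ (b : ℕ → A) → ¬ (∀ m n → m ℕ.< n → ¬ (b m ≤ b n))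
  no-bad {A = A} {_≈_} {_≤_} wpo b bad = noInfiniteAntichain (b ∘ index , antichain)
    where
    open IsWPO wpo
    open IsPartialOrder isPartialOrder renaming (refl to ≤-refl)

    -- Selects terms with no later term below them. Well-foundedness supplies them arbitrarily late,
    -- and a bad sequence restricted to them is an antichain.
    MinimalFrom : ℕ → ℕ → Set _
    MinimalFrom n m = n ℕ.≤ m × ∀ k → m ℕ.< k → ¬ (b k ≤ b m)

    minimalFrom : ∀ n → ∃ (MinimalFrom n)
    minimalFrom n = go n ℕ.≤-refl (wellFounded (b n))
      where
      go : ∀ m → n ℕ.≤ m → Acc (Strict._<_ _≈_ _≤_) (b m) → ∃ (MinimalFrom n)
      go m n≤m (acc rs) with lem {P = ∃ λ k → m ℕ.< k × b k ≤ b m}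
      ... | no ¬∃ = m , n≤m , λ k m<k bk≤bm → ¬∃ (k , m<k , bk≤bm)
      ... | yes (k , m<k , bk≤bm) = go k (ℕ.≤-trans n≤m (ℕ.<⇒≤ m<k))
        (rs (bk≤bm , λ bk≈bm → bad m k m<k (reflexive (Eq.sym bk≈bm))))

    index : ℕ → ℕ
    index zero = proj₁ (minimalFrom 0)
    index (suc n) = proj₁ (minimalFrom (suc (index n)))

    index-minimal : ∀ n k → index n ℕ.< k → ¬ (b k ≤ b (index n))
    index-minimal zero = proj₂ (proj₂ (minimalFrom 0))
    index-minimal (suc n) = proj₂ (proj₂ (minimalFrom (suc (index n))))

    index-< : ∀ {m n} → m ℕ.<′ n → index m ℕ.< index n
    index-< (ℕ.≤′-reflexive refl) = proj₁ (proj₂ (minimalFrom _))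
    index-< (ℕ.≤′-step m<n) = ℕ.<-trans (index-< m<n) (proj₁ (proj₂ (minimalFrom _)))

    antichain : ∀ i j → ¬ i ≡ j → ¬ (b (index i) ≤ b (index j))
    antichain i j i≢j with ℕ.<-cmp i j
    ... | tri< i<j _ _ = bad (index i) (index j) (index-< (ℕ.<⇒<′ i<j))
    ... | tri≈ _ i≡j _ = ⊥-elim (i≢j i≡j)
    ... | tri> _ _ j<i = index-minimal j (index i) (index-< (ℕ.<⇒<′ j<i))

  -- A strictly descending sequence of the extension is bad for `≤`: a relation `b m ≤ b n` with m <
  -- n would pass to the extension and contradict the descent.
  extension-wellFounded : ∀ {a ℓ₁ ℓ₂ ℓ₃} {A : Set a} {_≈_ : Rel A ℓ₁} {_≤_ : Rel A ℓ₂}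
    {_≤ᴸ_ : Rel A ℓ₃} → IsWPO _≈_ _≤_ → IsLinearExtension _≈_ _≤_ _≤ᴸ_ →
    WellFoundedOrder _≈_ _≤ᴸ_
  extension-wellFounded {A = A} {_≈_} {_≤_} {_≤ᴸ_} wpo (total , ≤⇒≤ᴸ) x₀ =
    by-contradiction λ ¬acc → no-bad wpo (term ¬acc) (bad ¬acc)
    where
    open IsTotalOrder total using (antisym) renaming (refl to ≤ᴸ-refl; trans to ≤ᴸ-trans)
    _<_ = Strict._<_ _≈_ _≤ᴸ_

    descend : ∀ {x} → ¬ Acc _<_ x → ∃ λ y → y < x × ¬ Acc _<_ y
    descend ¬acc = by-contradiction λ ¬∃ → ¬acc (acc λ {y} y<x →
      by-contradiction λ ¬acc-y → ¬∃ (y , y<x , ¬acc-y))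

    stage : ¬ Acc _<_ x₀ → ℕ → ∃ λ x → ¬ Acc _<_ x
    stage ¬acc zero = x₀ , ¬acc
    stage ¬acc (suc n) = let y , _ , ¬acc-y = descend (proj₂ (stage ¬acc n)) in y , ¬acc-y

    term : ¬ Acc _<_ x₀ → ℕ → A
    term ¬acc = proj₁ ∘ stage ¬acc

    step : ∀ ¬acc n → term ¬acc (suc n) < term ¬acc n
    step ¬acc n = proj₁ (proj₂ (descend (proj₂ (stage ¬acc n))))

    decreasing : ∀ ¬acc {m n} → m ℕ.≤′ n → term ¬acc n ≤ᴸ term ¬acc m
    decreasing ¬acc (ℕ.≤′-reflexive refl) = ≤ᴸ-refl
    decreasing ¬acc (ℕ.≤′-step {n} m≤n) = ≤ᴸ-trans (proj₁ (step ¬acc n)) (decreasing ¬acc m≤n)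

    bad : ∀ ¬acc m n → m ℕ.< n → ¬ (term ¬acc m ≤ term ¬acc n)
    bad ¬acc m n m<n bm≤bn = proj₂ (step ¬acc m)
      (antisym (proj₁ (step ¬acc m))
        (≤ᴸ-trans (≤⇒≤ᴸ bm≤bn) (decreasing ¬acc (ℕ.≤⇒≤′ m<n))))

  -- Breaking the ties of the total preorder `≲` by `≤ᴱ` gives a linear extension of `≤`, which
  -- embeds into α by maximality of the length. The two conditions on `x` and `y` say that `x`
  -- strictly precedes `y` in it.
  lexicographic-embedding :
    ∀ {c ℓ₁ ℓ₂ a ℓ₃ ℓ₄} {A : Set c} {_≈_ : Rel A ℓ₁} {_≤_ : Rel A ℓ₂} {α : Ordinal a ℓ₃ ℓ₄} →
    HasLength _≈_ _≤_ α →
    {_≤ᴱ_ : Rel A ℓ₂} → IsLinearExtension _≈_ _≤_ _≤ᴱ_ →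
    {_≲_ : Rel A ℓ₂} → Transitive _≲_ → Total _≲_ → _≤_ ⇒ _≲_ →
    ∃ λ (k : A → Ordinal.Carrier α) → ∀ {x y} → x ≲ y → (y ≲ x → x ≤ᴱ y × ¬ x ≈ y) →
      Rank._<_ α (k x) (k y)
  lexicographic-embedding {A = A} {_≈_} {_≤_} {α} len {_≤ᴱ_}
    (totᴱ , ≤⇒≤ᴱ) {_≲_} ≲-trans ≲-total ≤⇒≲ =
    k , λ {x} {y} x≲y cond →
      mono (x≲y , λ y≲x → proj₁ (cond y≲x)) , λ kx≈ky → x≉y x≲y cond (injective kx≈ky)
    where
    open HasLength len
    module E = IsTotalOrder totᴱ
    open IsPartialOrder (IsWPO.isPartialOrder isWPO) using () renaming (reflexive to ≤-reflexive)
    _≤ᴹ_ : Rel A _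
    x ≤ᴹ y = x ≲ y × (y ≲ x → x ≤ᴱ y)

    totalᴹ : Total _≤ᴹ_
    totalᴹ x y with lem {P = x ≲ y} | lem {P = y ≲ x}
    ... | no ¬p | no ¬q = [ ⊥-elim ∘ ¬p , ⊥-elim ∘ ¬q ]′ (≲-total x y)
    ... | yes p | no ¬q = inj₁ (p , ⊥-elim ∘ ¬q)
    ... | no ¬p | yes q = inj₂ (q , ⊥-elim ∘ ¬p)
    ... | yes p | yes q with E.total x y
    ...   | inj₁ x≤y = inj₁ (p , λ _ → x≤y)
    ...   | inj₂ y≤x = inj₂ (q , λ _ → y≤x)

    extᴹ : IsLinearExtension _≈_ _≤_ _≤ᴹ_
    extᴹ = record
      { isPartialOrder = record
        { isPreorder = record
          { isEquivalence = E.isEquivalence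
          ; reflexive = λ x≈y → ≤⇒≲ (≤-reflexive x≈y) , λ _ → E.reflexive x≈y
          ; trans = λ (x≲y , xy) (y≲z , yz) → ≲-trans x≲y y≲z , λ z≲x →
              E.trans (xy (≲-trans y≲z z≲x)) (yz (≲-trans z≲x x≲y))
          }
        ; antisym = λ (x≲y , xy) (y≲x , yx) → E.antisym (xy y≲x) (yx x≲y)
        }
      ; total = totalᴹ
      } , λ x≤y → ≤⇒≲ x≤y , λ _ → ≤⇒≤ᴱ x≤y

    μ : Ordinal _ _ _
    μ = record
      { totalOrder = record { isTotalOrder = proj₁ extᴹ }
      ; wellFounded = extension-wellFounded isWPO extᴹ
      }

    embedding : μ ≼ α
    embedding = maximal _≤ᴹ_ extᴹ μ (id , record
      { isOrderMonomorphism = record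
        { isOrderHomomorphism = record { cong = id ; mono = id }
        ; injective = id
        ; cancel = id
        }
      ; surjective = λ y → y , id
      })

    k = proj₁ embedding
    open IsOrderMonomorphism (proj₁ (proj₂ embedding)) using (mono; injective)

    x≉y : ∀ {x y} → x ≲ y → (y ≲ x → x ≤ᴱ y × ¬ x ≈ y) → ¬ x ≈ y
    x≉y x≲y cond x≈y = proj₂ (cond (≤⇒≲ (≤-reflexive (E.Eq.sym x≈y)))) x≈y

  -- Orderings of length ω: a numbering in which each element is below all but finitely many.

  record Enumeration {c ℓ₁ ℓ₂} {A : Set c} (_≈_ : Rel A ℓ₁) (_≤_ : Rel A ℓ₂) :
         Set (c ⊔ ℓ₁ ⊔ ℓ₂) where
    field
      code      : A → ℕ
      decode    : ℕ → A
      code-cong : ∀ {x y} → x ≈ y → code x ≡ code y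
      code-inj  : ∀ {x y} → code x ≡ code y → x ≈ y
      code∘decode : ∀ n → code (decode n) ≡ n
      cofinite  : ∀ x → ∃ λ N → ∀ y → ¬ (x ≤ y) → code y ℕ.< N

  enumeration : ∀ {c ℓ₁ ℓ₂} {A : Set c} {_≈_ : Rel A ℓ₁} {_≤_ : Rel A ℓ₂} →
                HasLength _≈_ _≤_ ω → Enumeration _≈_ _≤_
  enumeration {A = A} {_≈_} {_≤_} len = record
    { code = code
    ; decode = decode
    ; code-cong = cong
    ; code-inj = injective
    ; code∘decode = code∘decode
    ; cofinite = cofinite
    }
    where
    open HasLength len
    _≤ᵂ_ = proj₁ attained
    extᵂ = proj₁ (proj₂ attained)
    code = proj₁ (proj₂ (proj₂ attained))
    open IsOrderIsomorphism (proj₂ (proj₂ (proj₂ attained)))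
      using (cong; injective; cancel; surjective)
    open IsPartialOrder (IsWPO.isPartialOrder isWPO)
      using () renaming (trans to ≤-trans; module Eq to ≈)

    decode : ℕ → A
    decode n = proj₁ (surjective n)

    code∘decode : ∀ n → code (decode n) ≡ n
    code∘decode n = proj₂ (surjective n) ≈.refl

    -- Listing the elements not above x before all others keeps a linear
    -- extension; were they infinitely many, x would sit at an infinite position.
    cofinite : ∀ x → ∃ λ N → ∀ y → ¬ (x ≤ y) → code y ℕ.< N
    cofinite x = by-contradiction contra
      where
      _≲_ : Rel A _
      y ≲ z = x ≤ y → x ≤ z

      ≲-total : Total _≲_
      ≲-total y z with lem {P = x ≤ z}
      ... | yes x≤z = inj₁ λ _ → x≤z
      ... | no x≰z = inj₂ (⊥-elim ∘ x≰z)

      position : ∃ λ (k : A → ℕ) → ∀ {y z} → y ≲ z → (z ≲ y → y ≤ᵂ z × ¬ y ≈ z) →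
                 Rank._<_ ω (k y) (k z)
      position = lexicographic-embedding len extᵂ {_≲_} (λ y≲z z≲w → z≲w ∘ y≲z)
                   ≲-total (λ y≤z x≤y → ≤-trans x≤y y≤z)

      contra : ¬ ¬ (∃ λ N → ∀ y → ¬ (x ≤ y) → code y ℕ.< N)
      contra unbounded = ℕ.<⇒≱ below-x (k-term (k x))
        where
        k = proj₁ position

        k-< : ∀ {y z} → y ≲ z → (z ≲ y → y ≤ᵂ z × ¬ y ≈ z) → k y ℕ.< k z
        k-< p q = let ky≤kz , ky≢kz = proj₂ position p q in ℕ.≤∧≢⇒< ky≤kz ky≢kz

        beyond : ∀ N → ∃ λ y → ¬ (x ≤ y) × N ℕ.≤ code y
        beyond N = by-contradiction λ ¬∃ → unbounded (N , λ y x≰y →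
          ℕ.≰⇒> λ N≤y → ¬∃ (y , x≰y , N≤y))

        term : ℕ → ∃ λ y → ¬ (x ≤ y)
        term zero = let y , x≰y , _ = beyond 0 in y , x≰y
        term (suc n) = let y , x≰y , _ = beyond (suc (code (proj₁ (term n)))) in y , x≰y

        term-< : ∀ n → code (proj₁ (term n)) ℕ.< code (proj₁ (term (suc n)))
        term-< n = proj₂ (proj₂ (beyond (suc (code (proj₁ (term n))))))

        k-term : ∀ n → n ℕ.≤ k (proj₁ (term n))
        k-term zero = ℕ.z≤n
        k-term (suc n) = ℕ.≤-<-trans (k-term n)
          (k-< (⊥-elim ∘ proj₂ (term n)) λ _ →
            cancel (ℕ.<⇒≤ (term-< n)) , λ y≈z → ℕ.<⇒≢ (term-< n) (cong y≈z))

        below-x : k (proj₁ (term (k x))) ℕ.< k x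
        below-x = k-< (⊥-elim ∘ proj₂ (term (k x))) λ z≲y →
          ⊥-elim (proj₂ (term (k x)) (z≲y x≤x))
          where x≤x = IsPartialOrder.refl (IsWPO.isPartialOrder isWPO)

  -- The value `N` occurs at most once, so the threshold only has to move past that index.
  injective-unbounded : (g : ℕ → ℕ) → (∀ {i j} → g i ≡ g j → i ≡ j) →
                        ∀ N → ∃ λ J → ∀ j → J ℕ.≤ j → N ℕ.≤ g j
  injective-unbounded g g-inj zero = 0 , λ _ _ → ℕ.z≤n
  injective-unbounded g g-inj (suc N)
    with injective-unbounded g g-inj N | lem {P = ∃ λ j → g j ≡ N}
  ... | J , N≤g | no ¬∃ = J , λ j J≤j → ℕ.≤∧≢⇒< (N≤g j J≤j) λ N≡gj → ¬∃ (j , sym N≡gj)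
  ... | J , N≤g | yes (i , gi≡N) = J ℕ.⊔ suc i , λ j J⊔i<j →
    ℕ.≤∧≢⇒< (N≤g j (ℕ.≤-trans (ℕ.m≤m⊔n J (suc i)) J⊔i<j)) λ N≡gj →
      ℕ.<⇒≢ (ℕ.≤-trans (ℕ.m≤n⊔m J (suc i)) J⊔i<j) (g-inj (≡.trans gi≡N N≡gj))

  -- Every term of the antichain is `≤₁`-below almost all terms, so some subsequence increases for
  -- `≤₁`; being an antichain for the intersection, it is then bad for `≤₂`.
  ∩-noInfiniteAntichain :
    ∀ {c ℓ₁ ℓ₂} {A : Set c} {_≈_ : Rel A ℓ₁} {_≤_ _≤₁_ _≤₂_ : Rel A ℓ₂} →
    Reflexive _≤_ → _≤_ ⇔ (_≤₁_ ∩ _≤₂_) → Enumeration _≈_ _≤₁_ → IsWPO _≈_ _≤₂_ →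
    (∀ {x y} → x ≈ y → x ≤ y) →
    ¬ InfiniteAntichain _≤_
  ∩-noInfiniteAntichain {A = A} {_≤_ = _≤_} {_≤₁_} ≤-refl (_ , ∩⇒≤) enum wpo₂ ≈⇒≤ (b , antichain) =
    no-bad wpo₂ (b ∘ index) λ m n m<n bm≤₂bn →
      let i<j = index-< m<n in
      antichain (index m) (index n) (ℕ.<⇒≢ i<j) (∩⇒≤ (index-≤₁ m<n , bm≤₂bn))
    where
    open Enumeration enum

    code∘b-injective : ∀ {i j} → code (b i) ≡ code (b j) → i ≡ j
    code∘b-injective {i} {j} eq = by-contradiction λ i≢j → antichain i j i≢j (≈⇒≤ (code-inj eq))

    eventually : ∀ i → ∃ λ J → ∀ j → J ℕ.≤ j → b i ≤₁ b j
    eventually i =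
      let N , cof = cofinite (b i)
          J , N≤ = injective-unbounded (code ∘ b) code∘b-injective N
      in J , λ j J≤j → by-contradiction λ ≰₁ → ℕ.<⇒≱ (cof (b j) ≰₁) (N≤ j J≤j)

    index : ℕ → ℕ
    index zero = 0
    index (suc n) = suc (index n) ℕ.⊔ proj₁ (eventually (index n))

    index-step : ∀ n → index n ℕ.< index (suc n) × proj₁ (eventually (index n)) ℕ.≤ index (suc n)
    index-step n =
      ℕ.m≤m⊔n (suc (index n)) (proj₁ (eventually (index n))) ,
      ℕ.m≤n⊔m (suc (index n)) (proj₁ (eventually (index n)))

    index-mono : ∀ {m n} → m ℕ.≤′ n → index m ℕ.≤ index n
    index-mono (ℕ.≤′-reflexive refl) = ℕ.≤-refl
    index-mono (ℕ.≤′-step {n} m≤n) =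
      ℕ.≤-trans (index-mono m≤n) (ℕ.<⇒≤ (proj₁ (index-step n)))

    index-< : ∀ {m n} → m ℕ.< n → index m ℕ.< index n
    index-< {m} m<n = ℕ.≤-trans (proj₁ (index-step m)) (index-mono (ℕ.≤⇒≤′ m<n))

    index-≤₁ : ∀ {m n} → m ℕ.< n → b (index m) ≤₁ b (index n)
    index-≤₁ {m} {n} m<n = proj₂ (eventually (index m)) (index n)
      (ℕ.≤-trans (proj₂ (index-step m)) (index-mono (ℕ.≤⇒≤′ m<n)))

  -- Bounding the type of a linear extension by the rank of bad sequences.

  module Reindex
    (_≤_ : ℕ → ℕ → Set) (≤-refl : Reflexive _≤_) (≤-trans : Transitive _≤_)
    (≤-antisym : Antisymmetric _≡_ _≤_)
    (no-bad : ∀ (b : ℕ → ℕ) → ¬ (∀ m n → m ℕ.< n → ¬ (b m ≤ b n)))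
    (_≤ᴸ_ : ℕ → ℕ → Set) (totalᴸ : IsTotalOrder _≡_ _≤ᴸ_) (wfᴸ : WellFoundedOrder _≡_ _≤ᴸ_)
    (almost : ∀ x → ∃ λ N → ∀ y → y ≤ᴸ x → ¬ y ≡ x → x ≤ y → y ℕ.< N)
    where

    open WellQuasi _≤_ ≤-refl ≤-trans ≤-antisym no-bad

    λᴸ : Ordinal 0ℓ 0ℓ 0ℓ
    λᴸ = record { totalOrder = record { isTotalOrder = totalᴸ } ; wellFounded = wfᴸ }

    private module L = Rank λᴸ
    open L using (_<_)

    -- By induction the rank of `x` is at most the `o` of the points before `x`. Only finitely many
    -- of these lie above `x`, so inserting `x` raises `o`.
    rank⊏o : ∀ {x} → Acc _<_ x → ∀ {S : Pred ℕ 0ℓ} → (∀ {y} → y ≤ᴸ x → S y) →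
             L.rank x ⊏ o (wellQuasi S)
    rank⊏o {x} (acc rs) {S} ≤x⊆S =
      ⊏-⊑-trans (L.rank x) (o (wellQuasi up-to)) (o (wellQuasi S))
        (o-insert {_< x} {x} L.<-irrefl id
          (finite-bounded N λ {y} ((y≤x , y≢x) , x≤y) → <N y y≤x y≢x x≤y)
          (L.rank x) (⊑-build (L.rank x) (o (wellQuasi (_< x))) λ c c⊏ →
            let y , y<x , c⊑ = L.⊏-rank⁻ {γ = c} c⊏ in
            ⊑-⊏-trans c (L.rank y) (o (wellQuasi (_< x))) c⊑
              (rank⊏o (rs y<x) λ z≤y → L.≤-<-trans z≤y y<x)))
        (o-mono (wellQuasi up-to) (wellQuasi S)
          λ { (inj₁ (y≤x , _)) → ≤x⊆S y≤x ; (inj₂ refl) → ≤x⊆S L.≤-refl })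
      where
      N = proj₁ (almost x)
      <N = proj₂ (almost x)
      up-to : Pred ℕ 0ℓ
      up-to y = y < x ⊎ y ≡ x

    -- `node L.rank` is the ordinal type of the linear order. It is at most `o` of all of ℕ, hence
    -- realised there.
    reindex : ∃ λ (h : ℕ → ℕ) → ∀ {x y} → x < y → ¬ (h y ≤ h x)
    reindex = h ∘ L.rank , λ {x} {y} x<y →
      good (L.rank x) (L.rank y) (L.rank-< x<y) (child L.rank y)
      where
      realisation : Realises (node L.rank) U
      realisation = realise (⊏-wellFounded (node L.rank))
        (⊑-build (node L.rank) (o (wellQuasi U)) λ c (x , c⊑) →
          ⊑-⊏-trans c (L.rank x) (o (wellQuasi U)) c⊑ (rank⊏o (wfᴸ x) λ _ → tt))
      h = proj₁ realisation
      good = proj₂ (proj₂ realisation)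

  -- Excluded middle resizes every proposition to the lowest universe.
  ⌊_⌋ : ∀ {ℓ} → Set ℓ → Set
  ⌊ P ⌋ = True (lem {P = P})

  -- Embedding the type of an arbitrary linear extension into α.

  module Maximality
    {c ℓ₁ ℓ₂ a ℓ₃ ℓ₄} (p : Poset c ℓ₁ ℓ₂) (α : Ordinal a ℓ₃ ℓ₄)
    (_≤₁_ _≤₂_ : Rel (Poset.Carrier p) ℓ₂)
    (≤⇔∩ : Poset._≤_ p ⇔ (_≤₁_ ∩ _≤₂_))
    (enum : Enumeration (Poset._≈_ p) _≤₁_)
    (len₂ : HasLength (Poset._≈_ p) _≤₂_ α)
    (_≤ᴸ_ : Rel (Poset.Carrier p) ℓ₂)
    (extᴸ : IsLinearExtension (Poset._≈_ p) (Poset._≤_ p) _≤ᴸ_)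
    (β : Ordinal c ℓ₁ ℓ₂)
    (typeᴸ : HasOrdinalType (Poset._≈_ p) _≤ᴸ_ β)
    where

    open Poset p using (Carrier; _≈_; module Eq)
    open Enumeration enum
    open HasLength len₂ using (attained) renaming (isWPO to wpo₂)
    private
      module ≤₂ = IsPartialOrder (IsWPO.isPartialOrder wpo₂)
      module ≤ᴸ = IsTotalOrder (proj₁ extᴸ)
      module β = Rank β
      module α = Rank α
      module i = IsOrderIsomorphism (proj₂ typeᴸ)

    to : Carrier → β.Carrier
    to = proj₁ typeᴸ

    from : β.Carrier → Carrier
    from b = proj₁ (i.surjective b)

    to∘from : ∀ b → to (from b) β.≈ b
    to∘from b = proj₂ (i.surjective b) Eq.refl

    decode∘code : ∀ x → decode (code x) ≈ x
    decode∘code x = code-inj (code∘decode (code x))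

    decode-inj : ∀ {m n} → decode m ≈ decode n → m ≡ n
    decode-inj {m} {n} eq =
      ≡.trans (sym (code∘decode m)) (≡.trans (code-cong eq) (code∘decode n))

    _≤ᵠ_ _≤ˡ_ : ℕ → ℕ → Set
    m ≤ᵠ n = ⌊ decode m ≤₂ decode n ⌋
    m ≤ˡ n = ⌊ decode m ≤ᴸ decode n ⌋

    totalˡ : IsTotalOrder _≡_ _≤ˡ_
    totalˡ = record
      { isPartialOrder = record
        { isPreorder = record
          { isEquivalence = ≡.isEquivalence
          ; reflexive = λ { refl → fromWitness ≤ᴸ.refl }
          ; trans = λ x≤y y≤z → fromWitness (≤ᴸ.trans (toWitness x≤y) (toWitness y≤z))
          }
        ; antisym = λ x≤y y≤x → decode-inj (≤ᴸ.antisym (toWitness x≤y) (toWitness y≤x))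
        }
      ; total = λ m n → [ inj₁ ∘ fromWitness , inj₂ ∘ fromWitness ]′
                          (≤ᴸ.total (decode m) (decode n))
      }

    wfˡ : WellFoundedOrder _≡_ _≤ˡ_
    wfˡ = Subrelation.wellFounded
      (λ (m≤n , m≢n) → i.mono (toWitness m≤n) , m≢n ∘ decode-inj ∘ i.injective)
      (On.wellFounded (to ∘ decode) β.wellFounded)

    -- With `m ≤₁ n` as well, `m` would be below `n` in p and hence in the linear extension,
    -- contrary to `n` preceding `m`. So `n` is one of the finitely many elements not `≤₁`-above
    -- `m`.
    almost : ∀ m → ∃ λ N → ∀ n → n ≤ˡ m → ¬ n ≡ m → m ≤ᵠ n → n ℕ.< N
    almost m = let N , cof = cofinite (decode m) in N , λ n n≤ˡm n≢m m≤ᵠn →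
      subst (ℕ._< N) (code∘decode n) (cof (decode n) λ m≤₁n →
        n≢m (decode-inj (≤ᴸ.antisym (toWitness n≤ˡm)
          (proj₂ extᴸ (proj₂ ≤⇔∩ (m≤₁n , toWitness m≤ᵠn))))))

    codeOrdinal : Ordinal 0ℓ 0ℓ 0ℓ
    codeOrdinal = record
      { totalOrder = record { isTotalOrder = totalˡ } ; wellFounded = wfˡ }

    private module ˡ = Rank codeOrdinal

    module Reordered (h : ℕ → ℕ) (h-good : ∀ {x y} → x ˡ.< y → ¬ (h y ≤ᵠ h x)) where

      -- Comparing the up-sets Above y amounts to comparing the least n with y ≤ᵠ h n,
      -- where n = ∞ if there is none.
      Above : ℕ → ℕ → Set
      Above y n = ∃ λ m → m ≤ˡ n × y ≤ᵠ h m

      -- The lift is there because `maximal` ranges over relations at level `ℓ₂`.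
      _≲_ : Rel Carrier ℓ₂
      y ≲ z = Lift ℓ₂ (∀ n → Above (code z) n → Above (code y) n)

      ≲-total : Total _≲_
      ≲-total y z with lem {P = y ≲ z}
      ... | yes y≲z = inj₁ y≲z
      ... | no y≴z = inj₂ (lift λ n (m , m≤n , y≤hm) → by-contradiction λ ¬z-n →
        y≴z (lift λ n′ (m′ , m′≤n′ , z≤hm′) → [
          (λ n≤n′ → m , ˡ.≤-trans m≤n n≤n′ , y≤hm) ,
          (λ n′≤n → ⊥-elim (¬z-n (m′ , ˡ.≤-trans m′≤n′ n′≤n , z≤hm′))) ]′ (ˡ.total n n′)))

      ≤₂⇒≲ : _≤₂_ ⇒ _≲_
      ≤₂⇒≲ {y} {z} y≤z = lift λ n (m , m≤n , z≤hm) → m , m≤n ,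
        fromWitness (≤₂.trans (≤₂.reflexive (decode∘code y))
          (≤₂.trans y≤z (≤₂.trans (≤₂.reflexive (Eq.sym (decode∘code z))) (toWitness z≤hm))))

      position : ∃ λ (k : Carrier → α.Carrier) → ∀ {y z} → y ≲ z →
                 (z ≲ y → proj₁ attained y z × ¬ y ≈ z) → k y α.< k z
      position = lexicographic-embedding len₂ (proj₁ (proj₂ attained)) {_≲_}
        (λ (lift y≲z) (lift z≲w) → lift λ n → y≲z n ∘ z≲w n) ≲-total ≤₂⇒≲

      -- An index `m′` strictly before `n` with `h n ≤ᵠ h m′` contradicts `h-good`. With `h-above`,
      -- the up-set of `h n` is therefore exactly the final segment from `n`.
      above-h : ∀ {n m} → Above (code (decode (h n))) m → n ≤ˡ m
      above-h {n} {m} (m′ , m′≤m , hn≤hm′) = ˡ.≤-trans (by-contradiction λ n≰m′ →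
        h-good (ˡ.≰⇒> n≰m′) (subst (_≤ᵠ h m′) (code∘decode (h n)) hn≤hm′)) m′≤m

      h-above : ∀ {n m} → n ≤ˡ m → Above (code (decode (h n))) m
      h-above {n} n≤m = n , n≤m , subst (_≤ᵠ h n) (sym (code∘decode (h n))) (fromWitness ≤₂.refl)

      k : β.Carrier → α.Carrier
      k b = proj₁ position (decode (h (code (from b))))

      k-mono : ∀ {x y} → x β.< y → k x α.< k y
      k-mono {x} {y} (x≤y , x≉y) = proj₂ position
        (lift λ n y-n → h-above (ˡ.≤-trans (proj₁ code<) (above-h y-n)))
        -- No tie can occur here, since the final segments start at different indices.
        λ (lift z≲y) → ⊥-elim (ˡ.<⇒≱ code< (above-h (z≲y _ (h-above ˡ.≤-refl))))
        where
        from≤ : from x ≤ᴸ from y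
        from≤ = i.cancel (β.≤-trans (β.reflexive (to∘from x))
          (β.≤-trans x≤y (β.reflexive (β.Eq.sym (to∘from y)))))
        code< : code (from x) ˡ.< code (from y)
        code< = fromWitness (≤ᴸ.trans (≤ᴸ.reflexive (decode∘code _))
            (≤ᴸ.trans from≤ (≤ᴸ.reflexive (Eq.sym (decode∘code _))))) ,
          λ eq → x≉y (β.Eq.trans (β.Eq.sym (to∘from x))
            (β.Eq.trans (i.cong (code-inj eq)) (to∘from y)))

      β≼α : β ≼ α
      β≼α = strict⇒≼ β α k k-mono

    β≼α : β ≼ α
    β≼α = Reordered.β≼α (proj₁ reindexed) (proj₂ reindexed)
      where
      reindexed : ∃ λ (h : ℕ → ℕ) → ∀ {x y} → x ˡ.< y → ¬ (h y ≤ᵠ h x)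
      reindexed = Reindex.reindex _≤ᵠ_ (fromWitness ≤₂.refl)
        (λ x≤y y≤z → fromWitness (≤₂.trans (toWitness x≤y) (toWitness y≤z)))
        (λ x≤y y≤x → decode-inj (≤₂.antisym (toWitness x≤y) (toWitness y≤x)))
        (λ b bad → no-bad wpo₂ (decode ∘ b) λ m n m<n → bad m n m<n ∘ fromWitness)
        _≤ˡ_ totalˡ wfˡ almost

corollary1p2 : (∀ {ℓ} → ExcludedMiddle ℓ) →
    ∀ {c ℓ₁ ℓ₂ a ℓ₃ ℓ₄} (p : Poset c ℓ₁ ℓ₂) (α : Ordinal a ℓ₃ ℓ₄) →
    CountablyInfinite α →
    (_≤₁_ _≤₂_ : Rel (Poset.Carrier p) ℓ₂) →
    Poset._≤_ p ⇔ (_≤₁_ ∩ _≤₂_) →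
    HasLength (Poset._≈_ p) _≤₁_ ω →
    HasLength (Poset._≈_ p) _≤₂_ α →
    HasLength (Poset._≈_ p) (Poset._≤_ p) α
corollary1p2 lem p α _ _≤₁_ _≤₂_ ≤⇔∩ len₁ len₂ = record
  { isWPO = record
    { isPartialOrder = Poset.isPartialOrder p
    ; wellFounded = Subrelation.wellFounded
        (λ (x≤y , x≉y) → proj₂ (proj₁ ≤⇔∩ x≤y) , x≉y) (IsWPO.wellFounded wpo₂)
    ; noInfiniteAntichain =
        ∩-noInfiniteAntichain (Poset.refl p) ≤⇔∩ enum wpo₂ (Poset.reflexive p)
    }
  ; attained =
      -- A linear extension of `≤₂` also extends the smaller relation `≤`.
      let _≤ᴱ_ , (total , ≤₂⇒≤ᴱ) , type = HasLength.attained len₂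
      in _≤ᴱ_ , (total , ≤₂⇒≤ᴱ ∘ proj₂ ∘ proj₁ ≤⇔∩) , type
  ; maximal = Maximality.β≼α p α _≤₁_ _≤₂_ ≤⇔∩ enum len₂
  }
  where
  open Classical lem
  wpo₂ = HasLength.isWPO len₂
  enum = enumeration len₁
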